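{- Let $G$ be a directed or undirected graph with $m$ labeled edges. Then the directed graph $\mathrm{nr}(G)$ has $O(m)$ vertices and $O(m)$ edges, and it can be constructed from $G$ in time $O(m)$ if the edges of $G$ incident to each vertex are given grouped according to their labels.
   Context: Graphs are finite, each edge carries one label, and multiple edges are allowed. Isolated vertices are disregarded. Running times are on a standard random-access machine. The gadgets $D_k$. For $k\ge 1$, $D_k$ is a directed graph containing $2k$ distinct vertices labeled $1,\dots,k$ and $\bar 1,\dots,\bar k$ (and possibly other vertices), defined recursively. $D_1$ consists of the two vertices $1,\bar 1$ and no edges. $D_2$ consists of the four vertices $1,2,\bar 1,\bar 2$ with edges $1\to\bar 2$ and $2\to\bar 1$. For $k\ge 3$, take a copy $D'$ of $D_{\lceil k/2\rceil}$ and add new vertices labeled $1,\dots,k,\bar 1,\dots,\bar k$ (the labeled vertices of $D_k$ are these new ones). For each $1\le x\le k$ let $y=x+1$ if $x$ is odd, $y=x-1$ if $x$ is even, and $z=\lceil x/2\rceil$; add an edge from $x$ to $\bar y$ (if $y\le k$), an edge from $x$ to the vertex labeled $z$ of $D'$, and an edge from the vertex labeled $\bar z$ of $D'$ to $\bar x$. The graph $\mathrm{nr}(G)$. For each vertex $v$ of $G$, let $k_v$ be the number of distinct labels on edges incident to $v$ (incoming or outgoing, if $G$ is directed); $\mathrm{nr}(G)$ contains a separate copy of $D_{k_v}$, called the gadget of $v$, whose labeled vertices are renamed bijectively by the labels at $v$, so that each label $x$ at $v$ has a vertex $x$ and a vertex $\bar x$ in the gadget of $v$. For each edge $(v,w)$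 of $G$ labeled $x$, $\mathrm{nr}(G)$ has a directed edge from the vertex $\bar x$ of $v$'s gadget to the vertex $x$ of $w$'s gadget. If $G$ is undirected, each edge is treated as two oppositely oriented directed edges with the same label. -}

module Defs where

open import Data.Bool.Base using (if_then_else_)
open import Data.Fin.Base using (Fin; toℕ; zero; suc) renaming (_≤_ to _≤ᶠ_)
open import Data.Irrelevant using ([_])
open import Data.List.Base
  using (List; []; _∷_; _++_; length; lookup; map; concatMap; allFin; drop)
  renaming (head to headᴸ)
open import Data.List.Membership.Propositional using (_∈_)
open import Data.List.Relation.Unary.Unique.Propositional using (Unique)
open import Data.Maybe.Base using (Maybe; just; nothing; fromMaybe)
open import Data.Nat.Base
  using (ℕ; zero; suc; _+_; _*_; _∸_; _%_; _≡ᵇ_; ⌈_/2⌉)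
open import Data.Product.Base using (Σ; ∃; _×_; _,_)
open import Data.Refinement.Base using (Refinement; _,_)
open import Data.Sum.Base using (_⊎_; inj₁; inj₂)
open import Function.Bundles using (_↔_; _⇔_; Inverse)
open import Relation.Binary.PropositionalEquality using (_≡_; refl)

------------------------------------------------------------------------
-- Graphs

data Kind : Set where
  directed undirected : Kind

-- Loops and parallel edges are allowed.  In an undirected graph `tail e`
-- and `head e` are the two ends of e in an arbitrary order.  Isolated
-- vertices are excluded by `nonisolated`.
record Graph : Set where
  field
    kind        : Kind
    n m         : ℕ
    tail        : Fin m → Fin n
    head        : Fin m → Fin n
    label       : Fin m → ℕ

  Incident : Fin m → Fin n → Set
  Incident e v = tail e ≡ v ⊎ head e ≡ v

  field
    nonisolated : ∀ v → ∃ λ e → Incident e v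

  OccursAt : Fin n → ℕ → Set
  OccursAt v x = ∃ λ e → Incident e v × label e ≡ x

  -- Membership is proof-irrelevant, so this type has exactly one element
  -- per distinct label at v.
  LabelAt : Fin n → Set
  LabelAt v = Refinement ℕ (OccursAt v)

-- A directed multigraph.
record Digraph : Set₁ where
  field
    Vertex  : Set
    Edge    : Set
    source  : Edge → Vertex
    target  : Edge → Vertex

------------------------------------------------------------------------
-- The gadgets D k

-- The labelled vertices of D k carry the numbers 1,…,k.
num : ∀ {k} → Fin k → ℕ
num x = suc (toℕ x)

partner : ℕ → ℕ
partner x = if x % 2 ≡ᵇ 1 then x + 1 else x ∸ 1

-- `plain x` and `barred x` are the vertices x and x̄; `inner` embeds the
-- copy D′ of D ⌈ k /2⌉ into D k, for k ≥ 3.  (D 0 is empty and never used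
-- for a non-isolated vertex.)
data DVertex : ℕ → Set where
  plain  : ∀ {k} → Fin k → DVertex k
  barred : ∀ {k} → Fin k → DVertex k
  inner  : ∀ {k} → DVertex ⌈ 3 + k /2⌉ → DVertex (3 + k)

-- The equations in `cross`, `down` and `up` determine y and z from x and
-- have at most one proof, so they do not create parallel edges.  A z as in
-- `down` and `up` exists for every x; a y as in `cross` exists exactly
-- when partner (num x) ≤ k.
data DEdge : ℕ → Set where
  1→2̄   : DEdge 2
  2→1̄   : DEdge 2
  cross : ∀ {k} (x y : Fin (3 + k)) → num y ≡ partner (num x) → DEdge (3 + k)
  down  : ∀ {k} (x : Fin (3 + k)) (z : Fin ⌈ 3 + k /2⌉) →
          num z ≡ ⌈ num x /2⌉ → DEdge (3 + k)
  up    : ∀ {k} (x : Fin (3 + k)) (z : Fin ⌈ 3 + k /2⌉) →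
          num z ≡ ⌈ num x /2⌉ → DEdge (3 + k)
  inner : ∀ {k} → DEdge ⌈ 3 + k /2⌉ → DEdge (3 + k)

Dsource : ∀ {k} → DEdge k → DVertex k
Dsource 1→2̄           = plain zero
Dsource 2→1̄           = plain (suc zero)
Dsource (cross x y _) = plain x
Dsource (down x z _)  = plain x
Dsource (up x z _)    = inner (barred z)
Dsource (inner e)     = inner (Dsource e)

Dtarget : ∀ {k} → DEdge k → DVertex k
Dtarget 1→2̄           = barred (suc zero)
Dtarget 2→1̄           = barred zero
Dtarget (cross x y _) = barred y
Dtarget (down x z _)  = inner (plain z)
Dtarget (up x z _)    = barred x
Dtarget (inner e)     = inner (Dtarget e)

D : ℕ → Digraph
D k = record
  { Vertex = DVertex k ; Edge = DEdge k ; source = Dsource ; target = Dtarget }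

------------------------------------------------------------------------
-- The graph nr G

-- For every vertex v, the number k v of distinct labels at v and a
-- bijective renaming of 1,…,k v by these labels.  nr G is only determined
-- up to the choice of the renamings.
record Renaming (G : Graph) : Set where
  open Graph G
  field
    k      : Fin n → ℕ
    rename : ∀ v → Fin (k v) ↔ LabelAt v

-- An edge yields one arc in a directed graph and two opposite arcs in an
-- undirected one.
data Direction : Kind → Set where
  forward  : ∀ {κ} → Direction κ
  backward : Direction undirected

module NR (G : Graph) (ρ : Renaming G) where
  open Graph G
  open Renaming ρ

  NRVertex : Set
  NRVertex = Σ (Fin n) λ v → Digraph.Vertex (D (k v))

  data NREdge : Set where
    gadget : (v : Fin n) → Digraph.Edge (D (k v)) → NREdge
    arc    : Fin m → Direction kind → NREdge

  vertex : ∀ v → LabelAt v → NRVertex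
  vertex v x = v , plain (Inverse.from (rename v) x)

  vertex̄ : ∀ v → LabelAt v → NRVertex
  vertex̄ v x = v , barred (Inverse.from (rename v) x)

  labelAtTail : ∀ e → LabelAt (tail e)
  labelAtTail e = label e , [ (e , inj₁ refl , refl) ]

  labelAtHead : ∀ e → LabelAt (head e)
  labelAtHead e = label e , [ (e , inj₂ refl , refl) ]

  source : NREdge → NRVertex
  source (gadget v d)     = v , Digraph.source (D (k v)) d
  source (arc e forward)  = vertex̄ (tail e) (labelAtTail e)
  source (arc e backward) = vertex̄ (head e) (labelAtHead e)

  target : NREdge → NRVertex
  target (gadget v d)     = v , Digraph.target (D (k v)) d
  target (arc e forward)  = vertex (head e) (labelAtHead e)
  target (arc e backward) = vertex (tail e) (labelAtTail e)

  graph : Digraph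
  graph = record
    { Vertex = NRVertex ; Edge = NREdge ; source = source ; target = target }

nr : (G : Graph) → Renaming G → Digraph
nr = NR.graph

------------------------------------------------------------------------
-- Random-access machine (unit cost, addition and truncated subtraction,
-- indirect addressing).  A program has direct access to the registers it
-- mentions, which are finitely many.

data Instr : Set where
  const : (d c : ℕ) → Instr      -- R[d] ← c
  add   : (d a b : ℕ) → Instr    -- R[d] ← R[a] + R[b]
  sub   : (d a b : ℕ) → Instr    -- R[d] ← R[a] ∸ R[b]
  load  : (d a : ℕ) → Instr      -- R[d] ← M[R[a]]
  store : (a b : ℕ) → Instr      -- M[R[a]] ← R[b]
  jump  : (ℓ : ℕ) → Instr        -- go to ℓ
  jzero : (a ℓ : ℕ) → Instr      -- if R[a] = 0 go to ℓ

Program : Set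
Program = List Instr

record State : Set where
  constructor state
  field
    pc  : ℕ
    reg : ℕ → ℕ
    mem : ℕ → ℕ
open State public

_[_≔_] : (ℕ → ℕ) → ℕ → ℕ → ℕ → ℕ
(f [ a ≔ x ]) b = if b ≡ᵇ a then x else f b

exec : Instr → State → State
exec (const d c) (state p R M) = state (suc p) (R [ d ≔ c ]) M
exec (add d a b) (state p R M) = state (suc p) (R [ d ≔ R a + R b ]) M
exec (sub d a b) (state p R M) = state (suc p) (R [ d ≔ R a ∸ R b ]) M
exec (load d a)  (state p R M) = state (suc p) (R [ d ≔ M (R a) ]) M
exec (store a b) (state p R M) = state (suc p) R (M [ R a ≔ R b ])
exec (jump ℓ)    (state p R M) = state ℓ R M
exec (jzero a ℓ) (state p R M) = state (if R a ≡ᵇ 0 then ℓ else suc p) R M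

_at_ : ∀ {A : Set} → List A → ℕ → Maybe A
xs at i = headᴸ (drop i xs)

-- P ⊢ s ⇓[ t ] s′ : started in s, the program P halts in s′ after exactly
-- t steps.  It halts when there is no instruction at the program counter.
data _⊢_⇓[_]_ (P : Program) : State → ℕ → State → Set where
  halt : ∀ {s} → P at pc s ≡ nothing → P ⊢ s ⇓[ 0 ] s
  step : ∀ {s i t s′} → P at pc s ≡ just i →
         P ⊢ exec i s ⇓[ t ] s′ → P ⊢ s ⇓[ suc t ] s′

-- The input occupies the memory cells 0,1,…; everything else is 0.
initial : List ℕ → State
initial xs = state 0 (λ _ → 0) (λ i → fromMaybe 0 (xs at i))

StoredAt : State → ℕ → List ℕ → Set
StoredAt s a xs = ∀ (i : Fin (length xs)) → mem s (a + toℕ i) ≡ lookup xs i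

------------------------------------------------------------------------
-- Input and output representation

-- Equal entries are contiguous.
Grouped : List ℕ → Set
Grouped xs = ∀ (i j l : Fin (length xs)) → i ≤ᶠ j → j ≤ᶠ l →
             lookup xs i ≡ lookup xs l → lookup xs j ≡ lookup xs i

-- For every vertex, a list of its incident edges (a loop is listed once),
-- grouped by label.
record GroupedIncidence (G : Graph) : Set where
  open Graph G
  field
    edgesAt  : Fin n → List (Fin m)
    unique   : ∀ v → Unique (edgesAt v)
    complete : ∀ v e → (e ∈ edgesAt v) ⇔ Incident e v
    grouped  : ∀ v → Grouped (map label (edgesAt v))

kindCode : Kind → ℕ
kindCode directed   = 0
kindCode undirected = 1

encodeGraph : (G : Graph) → GroupedIncidence G → List ℕ
encodeGraph G I =
  kindCode kind ∷ n ∷ m ∷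
  concatMap (λ e → toℕ (tail e) ∷ toℕ (head e) ∷ label e ∷ []) (allFin m) ++
  concatMap (λ v → length (edgesAt v) ∷ map toℕ (edgesAt v)) (allFin n)
  where
  open Graph G
  open GroupedIncidence I

-- The encoding of a finite directed graph, given numberings of its vertices
-- and of its edges.
encodeDigraph : (H : Digraph) → let open Digraph H in
                ∀ {N M} → Vertex ↔ Fin N → Edge ↔ Fin M → List ℕ
encodeDigraph H {N} {M} ν ε =
  N ∷ M ∷
  concatMap (λ j → let e = Inverse.from ε j in
                   toℕ (Inverse.to ν (source e)) ∷
                   toℕ (Inverse.to ν (target e)) ∷ [])
            (allFin M)
  where open Digraph H

-- The names of the labelled vertices of nr G: for each edge e of G, with
-- label x, the numbers of the vertices x and x̄ in the gadgets of both ends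
-- of e.  Every labelled vertex of every gadget is listed.
encodeNames : (G : Graph) (ρ : Renaming G) →
              ∀ {N} → Digraph.Vertex (nr G ρ) ↔ Fin N → List ℕ
encodeNames G ρ ν =
  concatMap (λ e → number (vertex (tail e) (labelAtTail e)) ∷
                   number (vertex̄ (tail e) (labelAtTail e)) ∷
                   number (vertex (head e) (labelAtHead e)) ∷
                   number (vertex̄ (head e) (labelAtHead e)) ∷ [])
            (allFin m)
  where
  open Graph G
  open NR G ρ
  number : NRVertex → ℕ
  number u = toℕ (Inverse.to ν u)

-- In state s, register 0 points to an encoding of nr G (for some choice of
-- the renamings and numberings), and register 1 to the table of names.
record Represents-nr (G : Graph) (s : State) : Set where
  field
    ρ   : Renaming G
    N M : ℕ
    ν   : Digraph.Vertex (nr G ρ) ↔ Fin N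
    ε   : Digraph.Edge (nr G ρ) ↔ Fin M
    storedGraph : StoredAt s (reg s 0) (encodeDigraph (nr G ρ) ν ε)
    storedNames : StoredAt s (reg s 1) (encodeNames G ρ ν)

{-# OPTIONS --safe #-}
module Submission where

-- Size: over all levels of its recursion, D k has at most 3k labels, hence
-- O(k) vertices and edges, and the numbers k v of labels at the vertices add
-- up to at most 2m because each label at v occurs at an edge incident to v.
--
-- Time: the vertices are treated one after the other.  A scan of the incidence
-- list of v counts the groups, writes the names of the labelled vertices, and
-- is followed by the emission of the edges of the gadget of v, level by level;
-- the arcs come last and are read off the table of names.  The gadget of v
-- occupies consecutive numbers, with x at b + 2x, x̄ at b + 2x + 1 (x counted
-- from 0) and D′ from b + 2k on, so that the name of a label is known before
-- k v is.  The names lie behind the input and the graph behind the names.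

open import Defs
open import Data.Bool.Base using (Bool; true; false; not; _∧_; if_then_else_) renaming (T to IsTrue)
open import Data.Fin.Base using (Fin; toℕ; zero; suc; combine; fromℕ<)
open import Data.Fin.Properties
  using (toℕ-injective; toℕ-fromℕ<; toℕ<n; injective⇒≤; combine-injective; any?)
  renaming (_≟_ to _≟ᶠ_)
open import Data.Irrelevant using ([_])
open import Data.List.Base
  using (List; []; _∷_; _++_; length; lookup; map; concat; concatMap; allFin; tabulate; replicate)
open import Data.List.Membership.DecPropositional using (_∈?_)
open import Data.List.Membership.Propositional using (_∈_; _∉_; find)
open import Data.List.Membership.Propositional.Properties
open import Data.List.Properties
  using (++-assoc; ++-identityʳ; length-++; length-map; length-tabulate; length-replicate;
         map-++; map-∘; map-cong; map-concatMap; map-tabulate; tabulate-lookup;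
         concatMap-cong; concatMap-map)
open import Data.List.Relation.Unary.All as All using (All; []; _∷_)
open import Data.List.Relation.Unary.All.Properties as All using (¬Any⇒All¬)
open import Data.List.Relation.Unary.AllPairs as AllPairs using ([]; _∷_)
open import Data.List.Relation.Unary.AllPairs.Properties as AllPairs using ()
open import Data.List.Relation.Unary.Any using (here; there; index)
open import Data.List.Relation.Unary.Any.Properties using (lookup-index)
open import Data.List.Relation.Unary.Unique.Propositional using (Unique)
open import Data.List.Relation.Unary.Unique.Propositional.Properties as Unique using (allFin⁺)
open import Data.Maybe.Base using (just; nothing; fromMaybe)
open import Data.Nat.Base
open import Data.Nat.DivMod using ([m+kn]%n≡m%n; m*n%n≡0)
open import Data.Nat.ListAction using (sum)
open import Data.Nat.Properties
open import Data.Nat.Tactic.RingSolver using (solve-∀)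
open import Data.Product.Base using (Σ; ∃; ∃₂; _×_; _,_; proj₁; proj₂)
open import Data.Refinement.Base using (Refinement; _,_; value)
open import Data.Sum.Base using (_⊎_; inj₁; inj₂)
open import Data.Unit.Base using (⊤; tt)
open import Function.Base using (_∘_; id)
open import Function.Bundles using (_↔_; mk↔ₛ′; Inverse; Equivalence)
open import Relation.Binary.PropositionalEquality
open import Relation.Nullary using (Dec; yes; no; contradiction)
open import Relation.Nullary.Decidable using (recompute; _×-dec_; _⊎-dec_)

-- Arrays

-- An arc joins x̄ at one end of an edge to x at the other, and the two ends are in general visited
-- at different times, so neither visit knows both numbers. The table of names is where they meet;
-- this is why the arcs must wait until it is complete. Neither division nor parity is available on
-- the machine. A level is therefore emitted two partners at a time, and the number of rounds is the
-- size ⌈k/2⌉ of the next level. The visit to a vertex has a constant cost besides the cost per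
-- incident edge. It is charged to an incident edge, which exists because no vertex is isolated.
-- Input, names and graph share one memory. Instead of proving that writes to one area spare the
-- others, the proof fixes the final memory in advance and shows that every write agrees with it.
-- The machine has only jumps, so the program is written with conditionals and loops, given a
-- semantics with exact step counts, and compiled by a translation that is verified once. That a
-- register survives a piece of program is settled by evaluating a Boolean test.

Stored : {A : Set} → (ℕ → A → Set) → ℕ → List A → Set
Stored ρ a []       = ⊤
Stored ρ a (x ∷ xs) = ρ a x × Stored ρ (suc a) xs

Stored-++ : ∀ {A} {ρ : ℕ → A → Set} xs {ys a} → Stored ρ a (xs ++ ys) →
            Stored ρ a xs × Stored ρ (a + length xs) ys
Stored-++ {ρ = ρ} [] {ys} {a} p = tt , subst (λ b → Stored ρ b ys) (sym (+-identityʳ a)) p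
Stored-++ {ρ = ρ} (x ∷ xs) {ys} {a} (p , ps) with Stored-++ xs ps
... | qs , rs = (p , qs) , subst (λ b → Stored ρ b ys) (sym (+-suc a (length xs))) rs

at-length : ∀ {A : Set} (pre : List A) x post → (pre ++ x ∷ post) at length pre ≡ just x
at-length []        x post = refl
at-length (_ ∷ pre) x post = at-length pre x post

at-end : ∀ {A : Set} (xs : List A) → xs at length xs ≡ nothing
at-end []       = refl
at-end (_ ∷ xs) = at-end xs

Stored-at : ∀ {A : Set} (pre xs post : List A) →
            Stored (λ i x → (pre ++ xs ++ post) at i ≡ just x) (length pre) xs
Stored-at {A} pre []       post = tt
Stored-at {A} pre (x ∷ xs) post =
  at-length pre x (xs ++ post) ,
  subst₂ (λ ys b → Stored (λ i x → ys at i ≡ just x) b xs)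
    (++-assoc pre (x ∷ []) (xs ++ post))
    (trans (length-++ pre) (+-comm (length pre) 1))
    (Stored-at (pre ++ x ∷ []) xs post)

-- Structured programs

-- The instructions without jumps. Control flow comes from `Cmd` alone, so that programs are
-- verified along their structure and no program counter appears.
data Op : Set where
  const       : (d c : ℕ) → Op
  add sub     : (d a b : ℕ) → Op
  load store  : (a b : ℕ) → Op

instr : Op → Instr
instr (const d c) = const d c
instr (add d a b) = add d a b
instr (sub d a b) = sub d a b
instr (load d a)  = load d a
instr (store a b) = store a b

infixr 4 _⨟_

data Cmd : Set where
  ops   : List Op → Cmd
  _⨟_   : Cmd → Cmd → Cmd
  ifz   : ℕ → Cmd → Cmd → Cmd
  while : ℕ → Cmd → Cmd

record Store : Set where
  no-eta-equality
  pattern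
  constructor _,_
  field
    regs  : ℕ → ℕ
    cells : ℕ → ℕ
open Store public

effect : Op → Store → Store
effect (const d c) s = (regs s [ d ≔ c ]) , cells s
effect (add d a b) s = (regs s [ d ≔ regs s a + regs s b ]) , cells s
effect (sub d a b) s = (regs s [ d ≔ regs s a ∸ regs s b ]) , cells s
effect (load d a) s = (regs s [ d ≔ cells s (regs s a) ]) , cells s
effect (store a b) s = regs s , (cells s [ regs s a ≔ regs s b ])

run : List Op → Store → Store
run []       s = s
run (o ∷ os) s = run os (effect o s)

-- The times count the jumps of the compiled code: the zero branch of `ifz` pays for `jzero` only,
-- the other one also for the jump past the zero branch, and a round of `while` pays for the test
-- and the jump back.
data Exec : Cmd → Store → ℕ → Store → Set where
  ops        : ∀ {os s} → Exec (ops os) s (length os) (run os s)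
  _⨟_        : ∀ {c d s t s′ t′ s″} → Exec c s t s′ → Exec d s′ t′ s″ →
               Exec (c ⨟ d) s (t + t′) s″
  ifz-zero   : ∀ {r c d s t s′} → regs s r ≡ 0 → Exec c s t s′ →
               Exec (ifz r c d) s (suc t) s′
  ifz-suc    : ∀ {r c d s t s′ i} → regs s r ≡ suc i → Exec d s t s′ →
               Exec (ifz r c d) s (suc (t + 1)) s′
  while-zero : ∀ {r c s} → regs s r ≡ 0 → Exec (while r c) s 1 s
  while-suc  : ∀ {r c s t s′ t′ s″ i} → regs s r ≡ suc i → Exec c s t s′ →
               Exec (while r c) s′ t′ s″ → Exec (while r c) s (suc (t + suc t′)) s″

size : Cmd → ℕ
size (ops os)    = length os
size (c ⨟ d)     = size c + size d
size (ifz r c d) = suc (size d + suc (size c))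
size (while r c) = suc (size c + 1)

-- Jump targets are absolute, so the address `o` of the first instruction is passed along. In `ifz`
-- the nonzero branch comes first, because `jzero` falls through to it.
compile : ℕ → Cmd → Program
compile o (ops os)    = map instr os
compile o (c ⨟ d)     = compile o c ++ compile (o + size c) d
compile o (ifz r c d) =
  jzero r (suc o + size d + 1) ∷ compile (suc o) d ++
  jump (o + size (ifz r c d)) ∷ compile (suc o + size d + 1) c
compile o (while r c) =
  jzero r (o + size (while r c)) ∷ compile (suc o) c ++ jump o ∷ []

length-compile : ∀ o c → length (compile o c) ≡ size c
length-compile o (ops os) = length-map instr os
length-compile o (c ⨟ d) = trans (length-++ (compile o c))
  (cong₂ _+_ (length-compile o c) (length-compile _ d))
length-compile o (ifz r c d) = cong suc (trans (length-++ (compile (suc o) d))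
  (cong₂ (λ i j → i + suc j) (length-compile _ d) (length-compile _ c)))
length-compile o (while r c) = cong suc (trans (length-++ (compile (suc o) c))
  (cong (_+ 1) (length-compile _ c)))

module _ (P : Program) where

  Code : ℕ → List Instr → Set
  Code = Stored (λ i x → P at i ≡ just x)

  private
    Code-++ : ∀ {o} o′ c {is} → Code o (compile o′ c ++ is) →
              Code o (compile o′ c) × Code (o + size c) is
    Code-++ o′ c p with Stored-++ (compile o′ c) p
    ... | q , r = q , subst (λ l → Code (_ + l) _) (length-compile o′ c) r

  at-pc : ℕ → Store → State
  at-pc o s = state o (regs s) (cells s)

  private
    moved : ∀ {o o′ t f} s → o ≡ o′ → P ⊢ at-pc o s ⇓[ t ] f → P ⊢ at-pc o′ s ⇓[ t ] f
    moved s refl h = h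

    timed : ∀ {σ t t′ f} → t ≡ t′ → P ⊢ σ ⇓[ t ] f → P ⊢ σ ⇓[ t′ ] f
    timed refl h = h

    jumps : ∀ {b b′ o o′ R M t f} → b ≡ b′ →
            P ⊢ state (if b′ ≡ᵇ 0 then o else o′) R M ⇓[ t ] f →
            P ⊢ state (if b ≡ᵇ 0 then o else o′) R M ⇓[ t ] f
    jumps refl h = h

  run-sound : ∀ o os s {t f} → Code o (map instr os) →
              P ⊢ at-pc (o + length os) (run os s) ⇓[ t ] f →
              P ⊢ at-pc o s ⇓[ length os + t ] f
  run-sound o []       s code h = moved s (+-identityʳ o) h
  run-sound o (x ∷ os) s {t} {f} (i , code) h = step i
    (subst (λ s → P ⊢ s ⇓[ length os + t ] f) (effect-exec x)
      (run-sound (suc o) os (effect x s) code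
        (moved (run os (effect x s)) (+-suc o (length os)) h)))
    where
    effect-exec : ∀ x → at-pc (suc o) (effect x s) ≡ exec (instr x) (at-pc o s)
    effect-exec (const d c) = refl
    effect-exec (add d a b) = refl
    effect-exec (sub d a b) = refl
    effect-exec (load d a)  = refl
    effect-exec (store a b) = refl

  -- Runs on the machine are only described up to halting, and a fragment inside a program does not
  -- halt at its end. Hence the execution of the fragment is put in front of a given halting run
  -- that starts behind it.
  compile-sound : ∀ o c {s t s′ t′ f} → Code o (compile o c) → Exec c s t s′ →
                  P ⊢ at-pc (o + size c) s′ ⇓[ t′ ] f →
                  P ⊢ at-pc o s ⇓[ t + t′ ] f
  compile-sound o (ops os) {s} code ops h = run-sound o os s code h
  compile-sound o (c ⨟ d) {s} {s′ = s′} {t′ = u} code (_⨟_ {t = t} {t′ = t′} x y) h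
    with Code-++ o c code
  ... | code₁ , code₂ = timed {at-pc o s} (sym (+-assoc t t′ u))
    (compile-sound o c code₁ x
      (compile-sound (o + size c) d code₂ y
        (moved s′ (sym (+-assoc o (size c) (size d))) h)))
  compile-sound o (ifz r c d) {s′ = s′} (i , code) (ifz-zero z x) h
    with Code-++ (suc o) d code
  ... | _ , (_ , code₂) = step i (jumps z
    (compile-sound (suc o + size d + 1) c (subst (λ i → Code i (compile (suc o + size d + 1) c)) eq code₂) x
      (moved s′ eq′ h)))
    where
    eq : suc (suc (o + size d)) ≡ suc o + size d + 1
    eq = sym (+-comm (suc o + size d) 1)
    eq′ : o + suc (size d + suc (size c)) ≡ suc o + size d + 1 + size c
    eq′ = trans (+-suc o _) (cong suc (trans (sym (+-assoc o (size d) _))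
            (sym (+-assoc (o + size d) 1 (size c)))))
  compile-sound o (ifz r c d) {s} {t′ = u} (i , code) (ifz-suc {t = t} z x) h
    with Code-++ (suc o) d code
  ... | code₁ , (j , _) = step i (jumps z
    (timed {at-pc (suc o) s} (sym (+-assoc t 1 u)) (compile-sound (suc o) d code₁ x (step j h))))
  compile-sound o (while r c) (i , code) (while-zero z) h = step i (jumps z h)
  compile-sound o (while r c) {s} {t′ = u} (i , code) (while-suc {t = t} {t′ = t′} z x y) h
    with Code-++ (suc o) c code
  ... | code₁ , (j , _) = step i (jumps z
    (timed {at-pc (suc o) s} (sym (+-assoc t (suc t′) u))
      (compile-sound (suc o) c code₁ x
        (step j (compile-sound o (while r c) (i , code) y h)))))

compile-correct : ∀ c {R M t s} → Exec c (R , M) t s →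
                  ∃ λ p → compile 0 c ⊢ state 0 R M ⇓[ t ] state p (regs s) (cells s)
compile-correct c {R} {M} {t} {s} x = size c ,
  subst (λ t → compile 0 c ⊢ state 0 R M ⇓[ t ] state (size c) (regs s) (cells s)) (+-identityʳ t)
    (compile-sound P 0 c
      (subst (λ p → Stored (λ i x → p at i ≡ just x) 0 P) (++-identityʳ P) (Stored-at [] P []))
      x (halt (subst (λ i → P at i ≡ nothing) (length-compile 0 c) (at-end P))))
  where P = compile 0 c

-- Registers kept by a program

keepsOp : ℕ → Op → Bool
keepsOp r (const d c) = not (r ≡ᵇ d)
keepsOp r (add d a b) = not (r ≡ᵇ d)
keepsOp r (sub d a b) = not (r ≡ᵇ d)
keepsOp r (load d a)  = not (r ≡ᵇ d)
keepsOp r (store a b) = true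

keepsOps : ℕ → List Op → Bool
keepsOps r []       = true
keepsOps r (o ∷ os) = keepsOp r o ∧ keepsOps r os

keeps : ℕ → Cmd → Bool
keeps r (ops os)     = keepsOps r os
keeps r (c ⨟ d)      = keeps r c ∧ keeps r d
keeps r (ifz _ c d)  = keeps r c ∧ keeps r d
keeps r (while _ c)  = keeps r c

private
  ∧-true : ∀ {b c} → b ∧ c ≡ true → b ≡ true × c ≡ true
  ∧-true {true} {true} refl = refl , refl

  other : ∀ (f : ℕ → ℕ) d x {r} → not (r ≡ᵇ d) ≡ true → (f [ d ≔ x ]) r ≡ f r
  other f d x {r} p with r ≡ᵇ d
  ... | false = refl

  effect-keeps : ∀ o {s r} → keepsOp r o ≡ true → regs (effect o s) r ≡ regs s r
  effect-keeps (const d c) {s} p = other (regs s) d _ p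
  effect-keeps (add d a b) {s} p = other (regs s) d _ p
  effect-keeps (sub d a b) {s} p = other (regs s) d _ p
  effect-keeps (load d a)  {s} p = other (regs s) d _ p
  effect-keeps (store a b) p = refl

  run-keeps : ∀ os {s r} → keepsOps r os ≡ true → regs (run os s) r ≡ regs s r
  run-keeps []       p = refl
  run-keeps (o ∷ os) p = trans (run-keeps os (proj₂ (∧-true p))) (effect-keeps o (proj₁ (∧-true p)))

-- The frame rule for registers. For a concrete program and register the premise is `refl`, and
-- loops are covered whatever the number of their rounds.
kept : ∀ {c s t s′} → Exec c s t s′ → ∀ r → keeps r c ≡ true → regs s′ r ≡ regs s r
kept (ops {os}) r p         = run-keeps os p
kept (x ⨟ y) r p            = trans (kept y r (proj₂ (∧-true p))) (kept x r (proj₁ (∧-true p)))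
kept (ifz-zero _ x) r p     = kept x r (proj₁ (∧-true p))
kept (ifz-suc {c = c} _ x) r p = kept x r (proj₂ (∧-true {keeps r c} p))
kept (while-zero _) r p     = refl
kept (while-suc _ x y) r p  = trans (kept y r p) (kept x r p)

-- Arrays: lookup, concatenation and blocks of fixed width

module _ {A : Set} {ρ : ℕ → A → Set} where

  Stored-lookup : ∀ xs {a} → Stored ρ a xs → ∀ i → ρ (a + toℕ i) (lookup xs i)
  Stored-lookup (x ∷ xs) {a} (p , _)  zero    = subst (λ b → ρ b x) (sym (+-identityʳ a)) p
  Stored-lookup (x ∷ xs) {a} (_ , ps) (suc i) =
    subst (λ b → ρ b (lookup xs i)) (sym (+-suc a (toℕ i))) (Stored-lookup xs ps i)

  Stored-map : ∀ {σ : ℕ → A → Set} xs {a} →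
               (∀ i {x} → a ≤ i → i < a + length xs → ρ i x → σ i x) →
               Stored ρ a xs → Stored σ a xs
  Stored-map []       f _        = tt
  Stored-map (x ∷ xs) {a} f (p , ps) =
    f a ≤-refl (m<m+n a z<s) p ,
    Stored-map xs (λ i a<i i< → f i (<⇒≤ a<i) (subst (i <_) (sym (+-suc a (length xs))) i<)) ps

  Stored-append : ∀ xs {ys a} → Stored ρ a xs → Stored ρ (a + length xs) ys → Stored ρ a (xs ++ ys)
  Stored-append []       {ys} {a} _        qs = subst (λ b → Stored ρ b ys) (+-identityʳ a) qs
  Stored-append (x ∷ xs) {ys} {a} (p , ps) qs =
    p , Stored-append xs ps (subst (λ b → Stored ρ b ys) (+-suc a (length xs)) qs)

Stored-zip : ∀ {A : Set} {ρ σ : ℕ → A → Set} xs {a} → Stored ρ a xs → Stored σ a xs → Stored (λ i x → ρ i x × σ i x) a xs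
Stored-zip []       _        _        = tt
Stored-zip (x ∷ xs) (p , ps) (q , qs) = (p , q) , Stored-zip xs ps qs

Stored-via : ∀ {A B : Set} {ρ : ℕ → B → Set} (f : A → B) xs {a} →
             Stored (λ i x → ρ i (f x)) a xs → Stored ρ a (map f xs)
Stored-via f []       _        = tt
Stored-via f (x ∷ xs) (p , ps) = p , Stored-via f xs ps

module _ {A B : Set} {ρ : ℕ → B → Set} (f : A → List B) {w : ℕ} (width : ∀ x → length (f x) ≡ w) where

  private
    next : ∀ a i → (a + w) + i * w ≡ a + suc i * w
    next a i = +-assoc a w (i * w)

  Stored-blocks⁻ : ∀ {n} (g : Fin n → A) {a} → Stored ρ a (concatMap f (tabulate g)) →
                   ∀ i → Stored ρ (a + toℕ i * w) (f (g i))
  Stored-blocks⁻ g {a} p zero =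
    subst (λ b → Stored ρ b (f (g zero))) (sym (+-identityʳ a)) (proj₁ (Stored-++ (f (g zero)) p))
  Stored-blocks⁻ g {a} p (suc i) = subst (λ b → Stored ρ b (f (g (suc i)))) (next a (toℕ i))
    (Stored-blocks⁻ (g ∘ suc)
      (subst (λ l → Stored ρ (a + l) (concatMap f (tabulate (g ∘ suc)))) (width (g zero)) (proj₂ (Stored-++ (f (g zero)) p))) i)

  Stored-blocks⁺ : ∀ {n} (g : Fin n → A) {a} → (∀ i → Stored ρ (a + toℕ i * w) (f (g i))) →
                   Stored ρ a (concatMap f (tabulate g))
  Stored-blocks⁺ {zero}  g     p = tt
  Stored-blocks⁺ {suc n} g {a} p = Stored-append (f (g zero))
    (subst (λ b → Stored ρ b (f (g zero))) (+-identityʳ a) (p zero))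
    (Stored-blocks⁺ (g ∘ suc) λ i →
      subst (λ b → Stored ρ b (f (g (suc i))))
        (sym (trans (cong (λ l → a + l + toℕ i * w) (width (g zero))) (next a (toℕ i)))) (p (suc i)))

  length-blocks : ∀ xs → length (concatMap f xs) ≡ length xs * w
  length-blocks []       = refl
  length-blocks (x ∷ xs) = trans (length-++ (f x)) (cong₂ _+_ (width x) (length-blocks xs))

-- Listings of finite types

lookup-injective : ∀ {A : Set} {xs : List A} → Unique xs →
                   ∀ {i j} → lookup xs i ≡ lookup xs j → i ≡ j
lookup-injective (_ ∷ _) {zero}  {zero}  eq = refl
lookup-injective {xs = _ ∷ xs} (p ∷ _) {zero}  {suc j} eq =
  contradiction eq (All.lookup p (∈-lookup {xs = xs} j))
lookup-injective {xs = _ ∷ xs} (p ∷ _) {suc i} {zero}  eq =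
  contradiction (sym eq) (All.lookup p (∈-lookup {xs = xs} i))
lookup-injective (_ ∷ u) {suc i} {suc j} eq = cong suc (lookup-injective u eq)

listing : ∀ {A : Set} (xs : List A) → (∀ x → x ∈ xs) → Unique xs → A ↔ Fin (length xs)
listing xs complete u = mk↔ₛ′ (index ∘ complete) (lookup xs)
  (λ i → lookup-injective u (sym (lookup-index (complete (lookup xs i)))))
  (λ x → sym (lookup-index (complete x)))

module _ {A : Set} (num : A → ℕ) where

  Consecutive : ℕ → List A → Set
  Consecutive = Stored (λ i x → num x ≡ i)

  private
    num-lookup : ∀ {xs} → Consecutive 0 xs → ∀ i → num (lookup xs i) ≡ toℕ i
    num-lookup {xs} = Stored-lookup xs

  -- Here the number of an element is prescribed by `num`, and consecutiveness makes it the position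
  -- in the list. Vertices need this, since the machine computes their numbers; for edges only the
  -- order matters, and `listing` is enough.
  numbering : ∀ xs → (∀ x → x ∈ xs) → Consecutive 0 xs → A ↔ Fin (length xs)
  numbering xs complete p = mk↔ₛ′ (index ∘ complete) (lookup xs)
    (λ i → toℕ-injective (begin
      toℕ (index (complete (lookup xs i)))            ≡⟨ num-lookup p _ ⟨
      num (lookup xs (index (complete (lookup xs i)))) ≡⟨ cong num (lookup-index (complete (lookup xs i))) ⟨
      num (lookup xs i)                               ≡⟨ num-lookup p i ⟩
      toℕ i                                           ∎))
    (λ x → sym (lookup-index (complete x)))
    where open ≡-Reasoning

  toℕ-numbering : ∀ xs complete p x → toℕ (Inverse.to (numbering xs complete p) x) ≡ num x
  toℕ-numbering xs complete p x =
    trans (sym (num-lookup p _)) (cong num (sym (lookup-index (complete x))))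

-- Removes the detour of `encodeDigraph` through the numbers of the edges.
concatMap-lookup : ∀ {A B : Set} (f : A → List B) xs →
                   concatMap (f ∘ lookup xs) (allFin (length xs)) ≡ concatMap f xs
concatMap-lookup f xs = trans
  (cong concat (trans (map-tabulate id (f ∘ lookup xs))
    (sym (map-tabulate (lookup xs) f))))
  (cong (concatMap f) (tabulate-lookup xs))

unique-concatMap : ∀ {A B : Set} (f : A → List B) →
                   (∀ {x x′ y} → y ∈ f x → y ∈ f x′ → x ≡ x′) → (∀ x → Unique (f x)) →
                   ∀ {xs} → Unique xs → Unique (concatMap f xs)
unique-concatMap f inj unique {xs} u = Unique.concat⁺
  (All.map⁺ (All.universal unique xs))
  (AllPairs.map⁺ (AllPairs.map (λ x≢x′ → λ { (p , q) → x≢x′ (inj p q) }) u))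

∈-concatMap-allFin : ∀ {n} {B : Set} (f : Fin n → List B) i {y} → y ∈ f i → y ∈ concatMap f (allFin n)
∈-concatMap-allFin f i p = ∈-concat⁺′ p (∈-map⁺ f (∈-allFin i))

-- Sums

+-double : ∀ b k → b + k + k ≡ b + k * 2
+-double = solve-∀

total : ∀ {A : Set} → (A → ℕ) → List A → ℕ
total f xs = sum (map f xs)

length-concatMap : ∀ {A B : Set} (f : A → List B) xs → length (concatMap f xs) ≡ total (length ∘ f) xs
length-concatMap f []       = refl
length-concatMap f (x ∷ xs) = trans (length-++ (f x)) (cong (length (f x) +_) (length-concatMap f xs))

total-cong : ∀ {A : Set} {f g : A → ℕ} → (∀ x → f x ≡ g x) → ∀ xs → total f xs ≡ total g xs
total-cong f≡g xs = cong sum (map-cong f≡g xs)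

total-mono : ∀ {A : Set} {f g : A → ℕ} → (∀ x → f x ≤ g x) → ∀ xs → total f xs ≤ total g xs
total-mono f≤g []       = z≤n
total-mono f≤g (x ∷ xs) = +-mono-≤ (f≤g x) (total-mono f≤g xs)

total-* : ∀ {A : Set} c (f : A → ℕ) xs → total (λ x → c * f x) xs ≡ c * total f xs
total-* c f []       = sym (*-zeroʳ c)
total-* c f (x ∷ xs) = trans (cong (c * f x +_) (total-* c f xs)) (sym (*-distribˡ-+ c (f x) _))

total-1 : ∀ {A : Set} (xs : List A) → total (λ _ → 1) xs ≡ length xs
total-1 []       = refl
total-1 (x ∷ xs) = cong suc (total-1 xs)

-- Double counting of incidences

module _ (G : Graph) where
  open Graph G

  -- Every edge has two ends, so it is counted at most twice.
  total-incidences≤ : (κ : Fin n → ℕ) (edge : ∀ v → Fin (κ v) → Fin m) →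
               (∀ v i → Incident (edge v i) v) →
               (∀ v {i j} → edge v i ≡ edge v j → i ≡ j) →
               total κ (allFin n) ≤ 2 * m
  total-incidences≤ κ edge incident injective = begin
    total κ (allFin n)  ≡⟨ total-cong (λ v → trans (length-map (v ,_) (allFin (κ v))) (length-tabulate id)) (allFin n) ⟨
    total (length ∘ slots) (allFin n) ≡⟨ length-concatMap slots (allFin n) ⟨
    length all          ≤⟨ injective⇒≤ (λ eq → lookup-injective all-unique (code-injective _ _ eq)) ⟩
    2 * m               ∎
    where
    open ≤-Reasoning
    Slot = Σ (Fin n) (Fin ∘ κ)
    slots : Fin n → List Slot
    slots v = map (v ,_) (allFin (κ v))
    all = concatMap slots (allFin n)

    all-unique : Unique all
    all-unique = unique-concatMap slots
      (λ p q → trans (sym (cong proj₁ (proj₂ (proj₂ (∈-map⁻ _ p))))) (cong proj₁ (proj₂ (proj₂ (∈-map⁻ _ q)))))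
      (λ v → Unique.map⁺ (λ { refl → refl }) (allFin⁺ (κ v))) (allFin⁺ n)

    side : ∀ {e v} → Incident e v → Fin 2
    side (inj₁ _) = zero
    side (inj₂ _) = suc zero

    -- An edge and the choice of its tail or its head determine the vertex; at a given vertex the
    -- edge determines the index.
    code : Slot → Fin (2 * m)
    code (v , i) = combine (side (incident v i)) (edge v i)

    same : ∀ {e e′ v v′} (p : Incident e v) (q : Incident e′ v′) → side p ≡ side q → e ≡ e′ → v ≡ v′
    same (inj₁ refl) (inj₁ refl) _ refl = refl
    same (inj₂ refl) (inj₂ refl) _ refl = refl
    same (inj₁ _)    (inj₂ _)    ()
    same (inj₂ _)    (inj₁ _)    ()

    code-injective : ∀ s s′ → code s ≡ code s′ → s ≡ s′
    code-injective (v , i) (v′ , i′) eq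
      with combine-injective (side (incident v i)) (edge v i) (side (incident v′ i′)) (edge v′ i′) eq
    ... | p , q with same (incident v i) (incident v′ i′) p q
    ... | refl = cong (v ,_) (injective v q)

-- The recursion of the gadgets

data Halving : ℕ → Set where
  zero : Halving 0
  one  : Halving 1
  two  : Halving 2
  half : ∀ {k} → Halving ⌈ 3 + k /2⌉ → Halving (3 + k)

-- With the passage from k to ⌈k/2⌉ laid out as a derivation, all later recursions on gadgets are
-- structural.
halving : ∀ k → Halving k
halving k = go k ≤-refl
  where
  go : ∀ {f} k → k ≤ f → Halving k
  go 0 _ = zero
  go 1 _ = one
  go 2 _ = two
  -- `f` is fuel: ⌈ 3 + k /2⌉ computes to 2 + ⌊ k /2⌋, which is smaller than 3 + k.
  go {suc f} (suc (suc (suc k))) (s≤s p) =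
    half (go {f} (suc (suc ⌊ k /2⌋)) (≤-trans (s≤s (s≤s (⌊n/2⌋≤n k))) p))

-- The sum of the numbers of labels over all levels of the recursion.
labels : ∀ {k} → Halving k → ℕ
labels {k} (half h) = k + labels h
labels {k} _        = k

-- For K ≥ 3, rounding up still leaves ⌈K/2⌉ ≤ 2K/3. So three times the size of D′ is at most 2K,
-- and the K labels of the level itself bring the sum to 3K at most.
labels≤ : ∀ {k} (h : Halving k) → labels h ≤ 3 * k
labels≤ zero = z≤n
labels≤ one  = s≤s z≤n
labels≤ two  = s≤s (s≤s z≤n)
labels≤ (half {k} h) = begin
  3 + k + labels h                 ≤⟨ +-monoʳ-≤ (3 + k) (labels≤ h) ⟩
  3 + k + 3 * (2 + ⌊ k /2⌋)        ≡⟨ regroup k ⌊ k /2⌋ ⟩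
  9 + k + (⌊ k /2⌋ + ⌊ k /2⌋ + ⌊ k /2⌋) ≤⟨ +-monoʳ-≤ (9 + k) (+-mono-≤ twice (⌊n/2⌋≤n k)) ⟩
  9 + k + (k + k)                  ≡⟨ regroup′ k ⟩
  3 * (3 + k)                      ∎
  where
  open ≤-Reasoning
  twice : ⌊ k /2⌋ + ⌊ k /2⌋ ≤ k
  twice = ≤-trans (+-monoʳ-≤ ⌊ k /2⌋ (⌊n/2⌋≤⌈n/2⌉ k)) (≤-reflexive (⌊n/2⌋+⌈n/2⌉≡n k))
  regroup : ∀ k j → 3 + k + 3 * (2 + j) ≡ 9 + k + (j + j + j)
  regroup = solve-∀
  regroup′ : ∀ k → 9 + k + (k + k) ≡ 3 * (3 + k)
  regroup′ = solve-∀

-- Vertices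

labelled : ∀ {k} → Fin k → List (DVertex k)
labelled x = plain x ∷ barred x ∷ []

dvertices : ∀ {k} → Halving k → List (DVertex k)
dvertices {k} (half h) = concatMap labelled (allFin k) ++ map inner (dvertices h)
dvertices {k} _        = concatMap labelled (allFin k)

private
  ∈-labelled : ∀ {k} {x : Fin k} {u} → u ∈ labelled x → u ∈ concatMap labelled (allFin k)
  ∈-labelled {x = x} = ∈-concatMap-allFin labelled x

∈-dvertices : ∀ {k} (h : Halving k) u → u ∈ dvertices h
∈-dvertices one      (plain x)  = ∈-labelled (here refl)
∈-dvertices one      (barred x) = ∈-labelled (there (here refl))
∈-dvertices two      (plain x)  = ∈-labelled (here refl)
∈-dvertices two      (barred x) = ∈-labelled (there (here refl))
∈-dvertices (half h) (plain x)  = ∈-++⁺ˡ (∈-labelled (here refl))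
∈-dvertices (half h) (barred x) = ∈-++⁺ˡ (∈-labelled (there (here refl)))
∈-dvertices (half h) (inner u)  = ∈-++⁺ʳ _ (∈-map⁺ inner (∈-dvertices h u))

dnum : ∀ {k} → DVertex k → ℕ
dnum (plain x)     = toℕ x * 2
dnum (barred x)    = suc (toℕ x * 2)
dnum {k} (inner u) = k * 2 + dnum u

private
  length-labelled : ∀ k → length (concatMap (labelled {k}) (allFin k)) ≡ k * 2
  length-labelled k = trans (length-blocks {ρ = λ _ _ → ⊤} labelled (λ _ → refl) (allFin k))
    (cong (_* 2) (length-tabulate {n = k} id))

length-dvertices : ∀ {k} (h : Halving k) → length (dvertices h) ≡ labels h * 2
length-dvertices zero = refl
length-dvertices one  = refl
length-dvertices two  = refl
length-dvertices (half {k} h) = begin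
  length (concatMap labelled (allFin K) ++ map inner (dvertices h))
    ≡⟨ length-++ (concatMap (labelled {K}) (allFin K)) ⟩
  length (concatMap (labelled {K}) (allFin K)) + length (map DVertex.inner (dvertices h))
    ≡⟨ cong₂ _+_ (length-labelled K) (trans (length-map _ (dvertices h)) (length-dvertices h)) ⟩
  K * 2 + labels h * 2 ≡⟨ *-distribʳ-+ 2 K (labels h) ⟨
  (K + labels h) * 2 ∎
  where
  open ≡-Reasoning
  K = 3 + k

dnum-consecutive : ∀ {k} (h : Halving k) b → Consecutive (λ u → b + dnum u) b (dvertices h)
private
  labelled-consecutive : ∀ k b → Consecutive (λ u → b + dnum u) b (concatMap (labelled {k}) (allFin k))
  labelled-consecutive k b = Stored-blocks⁺ labelled (λ _ → refl) id
    (λ i → refl , +-suc b (toℕ i * 2) , tt)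
dnum-consecutive zero b = tt
dnum-consecutive one b = labelled-consecutive 1 b
dnum-consecutive two b = labelled-consecutive 2 b
dnum-consecutive (half {k} h) b = Stored-append (concatMap labelled (allFin K))
  (labelled-consecutive K b)
  (subst (λ l → Consecutive (λ u → b + dnum u) (b + l) (map inner (dvertices h))) (sym (length-labelled K))
    (Stored-via inner (dvertices h)
      (Stored-map (dvertices h) (λ i _ _ → trans (sym (+-assoc b (K * 2) _))) (dnum-consecutive h (b + K * 2)))))
  where K = 3 + k

-- Edges

module Level (k : ℕ) where
  K : ℕ
  K = 3 + k

  halfOf : Fin K → Fin ⌈ K /2⌉
  halfOf x = fromℕ< {⌊ toℕ x /2⌋} (s≤s (⌊n/2⌋-mono (s≤s⁻¹ (toℕ<n x))))

  toℕ-halfOf : ∀ x → toℕ (halfOf x) ≡ ⌊ toℕ x /2⌋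
  toℕ-halfOf x = toℕ-fromℕ< _

  crosses : (x : Fin K) → Dec (pred (partner (num x)) < K) → List (DEdge K)
  crosses x (yes p) = cross x (fromℕ< p) (trans (cong suc (toℕ-fromℕ< p)) (suc-partner (toℕ x))) ∷ []
    where
    suc-partner : ∀ i → suc (pred (partner (suc i))) ≡ partner (suc i)
    suc-partner i with suc i % 2 ≡ᵇ 1 in eq
    ... | true  = refl
    -- The number 1 is odd; an even positive number is at least 2, so its partner is still positive.
    suc-partner zero | false with () ← eq
    suc-partner (suc i) | false = refl
  crosses x (no _)  = []

  edgesFrom : Fin K → List (DEdge K)
  edgesFrom x = crosses x (_ <? K) ++
    down x (halfOf x) (cong suc (toℕ-halfOf x)) ∷
    up x (halfOf x) (cong suc (toℕ-halfOf x)) ∷ []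

  -- Sorts the edges of a level by the x that generates them, which for `up` belongs to the target.
  -- Lists for different x are thus disjoint, and no `inner` edge occurs in them.
  data From (x : Fin K) : DEdge K → Set where
    cross : ∀ {y p} → From x (cross x y p)
    down  : ∀ {z p} → From x (down x z p)
    up    : ∀ {z p} → From x (up x z p)

  From-unique : ∀ {x x′ e} → From x e → From x′ e → x ≡ x′
  From-unique cross cross = refl
  From-unique down  down  = refl
  From-unique up    up    = refl

  ∈-edgesFrom⁻ : ∀ {x e} → e ∈ edgesFrom x → From x e
  ∈-edgesFrom⁻ {x} p with pred (partner (num x)) <? K
  ∈-edgesFrom⁻ (here refl)                 | yes _ = cross
  ∈-edgesFrom⁻ (there (here refl))         | yes _ = down
  ∈-edgesFrom⁻ (there (there (here refl))) | yes _ = up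
  ∈-edgesFrom⁻ (here refl)                 | no _  = down
  ∈-edgesFrom⁻ (there (here refl))         | no _  = up

  edgesFrom-unique : ∀ x → Unique (edgesFrom x)
  edgesFrom-unique x with pred (partner (num x)) <? K
  ... | yes _ = ((λ ()) ∷ (λ ()) ∷ []) ∷ ((λ ()) ∷ []) ∷ [] ∷ []
  ... | no _  = ((λ ()) ∷ []) ∷ [] ∷ []

  private
    cross-≡ : ∀ {x y y′ : Fin K} {p p′} → DEdge.cross {k} x y p ≡ cross x y′ p′
    cross-≡ {y = y} {y′} {p} {p′} with toℕ-injective {i = y} {y′} (suc-injective (trans p (sym p′)))
    ... | refl = cong (cross _ _) (≡-irrelevant p p′)

    down-≡ : ∀ {x z z′ p p′} → DEdge.down {k} x z p ≡ down x z′ p′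
    down-≡ {z = z} {z′} {p} {p′} with toℕ-injective {i = z} {z′} (suc-injective (trans p (sym p′)))
    ... | refl = cong (down _ _) (≡-irrelevant p p′)

    up-≡ : ∀ {x z z′ p p′} → DEdge.up {k} x z p ≡ up x z′ p′
    up-≡ {z = z} {z′} {p} {p′} with toℕ-injective {i = z} {z′} (suc-injective (trans p (sym p′)))
    ... | refl = cong (up _ _) (≡-irrelevant p p′)

  ∈-edgesFrom⁺ : ∀ {x e} → From x e → e ∈ edgesFrom x
  ∈-edgesFrom⁺ {x} f with pred (partner (num x)) <? K
  ∈-edgesFrom⁺ cross | yes _ = here cross-≡
  ∈-edgesFrom⁺ (cross {y} {p}) | no ¬p = contradiction (subst (λ i → pred i < K) p (toℕ<n y)) ¬p
  ∈-edgesFrom⁺ {x} down | yes _ = there (here down-≡)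
  ∈-edgesFrom⁺ {x} down | no _  = here down-≡
  ∈-edgesFrom⁺ {x} up | yes _ = there (there (here up-≡))
  ∈-edgesFrom⁺ {x} up | no _  = there (here up-≡)

  level : List (DEdge K)
  level = concatMap edgesFrom (allFin K)

  From⇒∈ : ∀ {x e} → From x e → e ∈ level
  From⇒∈ {x} f = ∈-concatMap-allFin edgesFrom x (∈-edgesFrom⁺ f)

  level-unique : Unique level
  level-unique = unique-concatMap edgesFrom
    (λ p q → From-unique (∈-edgesFrom⁻ p) (∈-edgesFrom⁻ q)) edgesFrom-unique (allFin⁺ K)

  length-level : length level ≤ 3 * K
  length-level = begin
    length level                            ≡⟨ length-concatMap edgesFrom (allFin K) ⟩
    total (length ∘ edgesFrom) (allFin K)   ≤⟨ total-mono three (allFin K) ⟩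
    total (λ _ → 3 * 1) (allFin K)          ≡⟨ total-* 3 (λ _ → 1) (allFin K) ⟩
    3 * total (λ _ → 1) (allFin K)          ≡⟨ cong (3 *_) (trans (total-1 (allFin K)) (length-tabulate {n = K} id)) ⟩
    3 * K                                   ∎
    where
    open ≤-Reasoning
    three : ∀ x → length (edgesFrom x) ≤ 3
    three x with pred (partner (num x)) <? K
    ... | yes _ = ≤-refl
    ... | no _  = n≤1+n 2

open Level using (level; edgesFrom; cross; down; up)

dedges : ∀ {k} → Halving k → List (DEdge k)
dedges zero     = []
dedges one      = []
dedges two      = 1→2̄ ∷ 2→1̄ ∷ []
dedges (half {k} h) = level k ++ map inner (dedges h)

∈-dedges : ∀ {k} (h : Halving k) e → e ∈ dedges h
∈-dedges two      1→2̄           = here refl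
∈-dedges two      2→1̄           = there (here refl)
∈-dedges (half h) (cross x y p) = ∈-++⁺ˡ (Level.From⇒∈ _ cross)
∈-dedges (half h) (down x z p)  = ∈-++⁺ˡ (Level.From⇒∈ _ down)
∈-dedges (half h) (up x z p)    = ∈-++⁺ˡ (Level.From⇒∈ _ up)
∈-dedges (half h) (inner e)     = ∈-++⁺ʳ _ (∈-map⁺ inner (∈-dedges h e))

dedges-unique : ∀ {k} (h : Halving k) → Unique (dedges h)
dedges-unique zero = []
dedges-unique one  = []
dedges-unique two  = ((λ ()) ∷ []) ∷ [] ∷ []
dedges-unique (half {k} h) = Unique.++⁺ (Level.level-unique k)
  (Unique.map⁺ (λ { refl → refl }) (dedges-unique h)) disjoint
  where
  disjoint : ∀ {e} → e ∈ level k × e ∈ map inner (dedges h) → _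
  disjoint (p , q) with ∈-map⁻ DEdge.inner q
  ... | _ , _ , refl with ∈-concatMap⁻ (edgesFrom k) {xs = allFin (3 + k)} p
  ... | r with find r
  ... | _ , _ , s with () ← Level.∈-edgesFrom⁻ k s

length-dedges : ∀ {k} (h : Halving k) → length (dedges h) ≤ 3 * labels h
length-dedges zero = z≤n
length-dedges one  = z≤n
length-dedges two  = s≤s (s≤s z≤n)
length-dedges (half {k} h) = begin
  length (level k ++ map inner (dedges h))         ≡⟨ length-++ (level k) ⟩
  length (level k) + length (map DEdge.inner (dedges h)) ≡⟨ cong (length (level k) +_) (length-map _ (dedges h)) ⟩
  length (level k) + length (dedges h)             ≤⟨ +-mono-≤ (Level.length-level k) (length-dedges h) ⟩
  3 * (3 + k) + 3 * labels h                       ≡⟨ *-distribˡ-+ 3 (3 + k) (labels h) ⟨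
  3 * (3 + k + labels h)                           ∎
  where open ≤-Reasoning

-- Numerical form of the edges

-- One level as the machine emits it. Here `x` and `y` are vertex numbers, of a label of D k and of
-- the corresponding label of D′, and `r` labels remain. Two partners share their vertex of D′, so
-- they are treated together, in steps of 4 and 2; a single remaining label is the last one of an
-- odd level and has no partner.
levelPairs : (x y r : ℕ) → List (ℕ × ℕ)
levelPairs x y 0 = []
levelPairs x y 1 = (x , y) ∷ (1 + y , 1 + x) ∷ []
levelPairs x y (suc (suc r)) =
  (x , 3 + x) ∷ (x , y) ∷ (1 + y , 1 + x) ∷
  (2 + x , 1 + x) ∷ (2 + x , y) ∷ (1 + y , 3 + x) ∷ levelPairs (4 + x) (2 + y) r

gadgetPairs : ∀ {k} → Halving k → ℕ → List (ℕ × ℕ)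
gadgetPairs two      b = (b , 3 + b) ∷ (2 + b , 1 + b) ∷ []
gadgetPairs {k} (half h) b = levelPairs b (b + k * 2) k ++ gadgetPairs h (b + k * 2)
gadgetPairs _        b = []

ends : ∀ {k} → ℕ → DEdge k → ℕ × ℕ
ends b e = b + dnum (Dsource e) , b + dnum (Dtarget e)

module _ (k b : ℕ) where
  open Level k using (K; halfOf; toℕ-halfOf)

  crossPairs : ∀ i → Dec (pred (partner (suc i)) < K) → List (ℕ × ℕ)
  crossPairs i (yes _) = (b + i * 2 , b + suc (pred (partner (suc i)) * 2)) ∷ []
  crossPairs i (no _)  = []

  pairsFrom : ℕ → List (ℕ × ℕ)
  pairsFrom i = crossPairs i (_ <? K) ++
    (b + i * 2 , b + (K * 2 + ⌊ i /2⌋ * 2)) ∷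
    (b + (K * 2 + suc (⌊ i /2⌋ * 2)) , b + suc (i * 2)) ∷ []

  ends-edgesFrom : ∀ x → map (ends b) (edgesFrom k x) ≡ pairsFrom (toℕ x)
  ends-edgesFrom x with pred (partner (num x)) <? K
  ... | yes p = cong₂ _∷_
    (cong (λ i → b + toℕ x * 2 , b + suc (i * 2)) (toℕ-fromℕ< p))
    (cong₂ (λ i j → (b + toℕ x * 2 , b + (K * 2 + i * 2)) ∷ (b + (K * 2 + suc (j * 2)) , b + suc (toℕ x * 2)) ∷ []) (toℕ-halfOf x) (toℕ-halfOf x))
  ... | no _ =
    (cong₂ (λ i j → (b + toℕ x * 2 , b + (K * 2 + i * 2)) ∷ (b + (K * 2 + suc (j * 2)) , b + suc (toℕ x * 2)) ∷ []) (toℕ-halfOf x) (toℕ-halfOf x))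

  pairsUpFrom : ℕ → ℕ → List (ℕ × ℕ)
  pairsUpFrom i 0       = []
  pairsUpFrom i (suc r) = pairsFrom i ++ pairsUpFrom (suc i) r

  private
    upFrom : ∀ i {r} (g : Fin r → ℕ) → (∀ x → g x ≡ i + toℕ x) →
             concatMap pairsFrom (tabulate g) ≡ pairsUpFrom i r
    upFrom i {zero}  g eq = refl
    upFrom i {suc r} g eq = cong₂ _++_ (cong pairsFrom (trans (eq zero) (+-identityʳ i)))
      (upFrom (suc i) (g ∘ suc) (λ x → trans (eq (suc x)) (+-suc i (toℕ x))))

    partner-odd : ∀ z → partner (suc (z * 2)) ≡ suc (suc (z * 2))
    partner-odd z = trans
      (cong (λ r → if r ≡ᵇ 1 then suc (z * 2) + 1 else z * 2) ([m+kn]%n≡m%n 1 z 2))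
      (+-comm (suc (z * 2)) 1)

    partner-even : ∀ z → partner (suc (suc (z * 2))) ≡ suc (z * 2)
    partner-even z =
      cong (λ r → if r ≡ᵇ 1 then suc (suc (z * 2)) + 1 else suc (z * 2)) (m*n%n≡0 (suc z) 2)

    ⌊z*2/2⌋ : ∀ z → ⌊ z * 2 /2⌋ ≡ z
    ⌊z*2/2⌋ zero    = refl
    ⌊z*2/2⌋ (suc z) = cong suc (⌊z*2/2⌋ z)

    ⌊1+z*2/2⌋ : ∀ z → ⌊ suc (z * 2) /2⌋ ≡ z
    ⌊1+z*2/2⌋ zero    = refl
    ⌊1+z*2/2⌋ (suc z) = cong suc (⌊1+z*2/2⌋ z)

    crossPairs-yes : ∀ {i j} d → partner (suc i) ≡ suc j → j < K →
                     crossPairs i d ≡ (b + i * 2 , b + suc (j * 2)) ∷ []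
    crossPairs-yes {i} (yes _) eq p = cong (λ l → (b + i * 2 , b + suc (pred l * 2)) ∷ []) eq
    crossPairs-yes (no ¬p) eq p = contradiction (subst (λ l → pred l < K) (sym eq) p) ¬p

    crossPairs-no : ∀ {i j} d → partner (suc i) ≡ suc j → K ≤ j → crossPairs i d ≡ []
    crossPairs-no (yes p) eq q = contradiction (subst (λ l → pred l < K) eq p) (≤⇒≯ q)
    crossPairs-no (no _) eq q = refl

    evenPairs : ∀ z → pairsFrom (z * 2) ≡ crossPairs (z * 2) (_ <? K) ++
      (b + z * 2 * 2 , b + K * 2 + z * 2) ∷ (1 + (b + K * 2 + z * 2) , 1 + (b + z * 2 * 2)) ∷ []
    evenPairs z = cong (crossPairs (z * 2) (_ <? K) ++_) (cong₂ (λ p q → p ∷ q ∷ [])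
      (cong (b + z * 2 * 2 ,_) (trans (cong (λ l → b + (K * 2 + l * 2)) (⌊z*2/2⌋ z)) (sym (+-assoc b (K * 2) _))))
      (cong₂ _,_ (trans (cong (λ l → b + (K * 2 + suc (l * 2))) (⌊z*2/2⌋ z)) (e b (K * 2) (z * 2))) (+-suc b _)))
      where
      e : ∀ b k z → b + (k + suc z) ≡ 1 + (b + k + z)
      e = solve-∀

    oddPairs : ∀ z → pairsFrom (suc (z * 2)) ≡ crossPairs (suc (z * 2)) (_ <? K) ++
      (2 + (b + z * 2 * 2) , b + K * 2 + z * 2) ∷ (1 + (b + K * 2 + z * 2) , 3 + (b + z * 2 * 2)) ∷ []
    oddPairs z = cong (crossPairs (suc (z * 2)) (_ <? K) ++_) (cong₂ (λ p q → p ∷ q ∷ [])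
      (cong₂ _,_ (e′ b (z * 2 * 2)) (trans (cong (λ l → b + (K * 2 + l * 2)) (⌊1+z*2/2⌋ z)) (sym (+-assoc b (K * 2) _))))
      (cong₂ _,_ (trans (cong (λ l → b + (K * 2 + suc (l * 2))) (⌊1+z*2/2⌋ z)) (e b (K * 2) (z * 2))) (e″ b (z * 2 * 2))))
      where
      e : ∀ b k z → b + (k + suc z) ≡ 1 + (b + k + z)
      e = solve-∀
      e′ : ∀ b z → b + (2 + z) ≡ 2 + (b + z)
      e′ = solve-∀
      e″ : ∀ b z → b + (3 + z) ≡ 3 + (b + z)
      e″ = solve-∀

    e₁ : ∀ b z → b + (1 + (1 + z * 2) * 2) ≡ 3 + (b + z * 2 * 2)
    e₁ = solve-∀
    e₂ : ∀ b z → b + (1 + z * 2) * 2 ≡ 2 + (b + z * 2 * 2)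
    e₂ = solve-∀
    e₃ : ∀ b z → b + (1 + z * 2 * 2) ≡ 1 + (b + z * 2 * 2)
    e₃ = solve-∀
    e₄ : ∀ b z → b + (1 + z) * 2 * 2 ≡ 4 + (b + z * 2 * 2)
    e₄ = solve-∀
    e₅ : ∀ y z → y + (1 + z) * 2 ≡ 2 + (y + z * 2)
    e₅ = solve-∀

    below : ∀ i z r → z * 2 + (2 + r) ≡ K → i < 2 → i + z * 2 < K
    below i z r eq p = subst₂ _<_ (+-comm (z * 2) i) eq
      (+-monoʳ-< (z * 2) (≤-trans p (m≤m+n 2 r)))

  -- Induction in steps of two labels, after `z` pairs of partners. The equation settles the cross
  -- edges: both partners lie below K as long as two labels remain, while a single remaining label
  -- has its partner beyond the end.
  pairsUpFrom-level : ∀ z r → z * 2 + r ≡ K →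
                      pairsUpFrom (z * 2) r ≡ levelPairs (b + z * 2 * 2) (b + K * 2 + z * 2) r
  pairsUpFrom-level z 0 eq = refl
  pairsUpFrom-level z 1 eq
    rewrite evenPairs z
          | crossPairs-no {z * 2} (_ <? K) (partner-odd z) (≤-reflexive (trans (sym eq) (+-comm (z * 2) 1)))
    = refl
  pairsUpFrom-level z (suc (suc r)) eq
    rewrite evenPairs z | oddPairs z
          | crossPairs-yes {z * 2} (_ <? K) (partner-odd z) (below 1 z r eq (s≤s (s≤s z≤n)))
          | crossPairs-yes {suc (z * 2)} (_ <? K) (partner-even z) (below 0 z r eq (s≤s z≤n))
          | e₁ b z | e₂ b z | e₃ b z
    = cong (λ ps → _ ∷ _ ∷ _ ∷ _ ∷ _ ∷ _ ∷ ps)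
        (trans (pairsUpFrom-level (suc z) r (trans (shift (z * 2) r) eq))
          (cong₂ (λ x y → levelPairs x y r) (e₄ b z) (e₅ (b + K * 2) z)))
    where
    shift : ∀ z r → 2 + z + r ≡ z + (2 + r)
    shift = solve-∀

  ends-level : map (ends b) (level k) ≡ levelPairs b (b + K * 2) K
  ends-level = begin
    map (ends b) (level k)                            ≡⟨ map-concatMap (ends b) (edgesFrom k) (allFin K) ⟩
    concatMap (map (ends b) ∘ edgesFrom k) (allFin K) ≡⟨ concatMap-cong ends-edgesFrom (allFin K) ⟩
    concatMap (pairsFrom ∘ toℕ) (allFin K)            ≡⟨ cong concat (trans (map-tabulate {n = K} id (pairsFrom ∘ toℕ)) (sym (map-tabulate {n = K} toℕ pairsFrom))) ⟩
    concatMap pairsFrom (tabulate {n = K} toℕ)        ≡⟨ upFrom 0 {K} toℕ (λ _ → refl) ⟩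
    pairsUpFrom 0 K                                   ≡⟨ pairsUpFrom-level 0 K refl ⟩
    levelPairs (b + 0) (b + K * 2 + 0) K              ≡⟨ cong₂ (λ x y → levelPairs x y K) (+-identityʳ b) (+-identityʳ _) ⟩
    levelPairs b (b + K * 2) K                        ∎
    where open ≡-Reasoning

ends-dedges : ∀ {k} (h : Halving k) b → map (ends b) (dedges h) ≡ gadgetPairs h b
ends-dedges zero b = refl
ends-dedges one  b = refl
ends-dedges two  b = cong₂ (λ p q → p ∷ q ∷ [])
  (cong₂ _,_ (+-identityʳ b) (+-comm b 3)) (cong₂ _,_ (+-comm b 2) (+-comm b 1))
ends-dedges (half {k} h) b = begin
  map (ends b) (level k ++ map inner (dedges h))                 ≡⟨ map-++ (ends b) (level k) _ ⟩
  map (ends b) (level k) ++ map (ends b) (map inner (dedges h))  ≡⟨ cong₂ _++_ (ends-level k b) (sym (map-∘ (dedges h))) ⟩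
  levelPairs b (b + K * 2) K ++ map (ends b ∘ inner) (dedges h)  ≡⟨ cong (levelPairs b (b + K * 2) K ++_) (map-cong (λ e → cong₂ _,_ (sym (+-assoc b (K * 2) _)) (sym (+-assoc b (K * 2) _))) (dedges h)) ⟩
  levelPairs b (b + K * 2) K ++ map (ends (b + K * 2)) (dedges h) ≡⟨ cong (levelPairs b (b + K * 2) K ++_) (ends-dedges h (b + K * 2)) ⟩
  levelPairs b (b + K * 2) K ++ gadgetPairs h (b + K * 2)        ∎
  where
  open ≡-Reasoning
  K = 3 + k

-- Enumeration of the vertices and edges of nr G

offset : ∀ {n} → (Fin n → ℕ) → Fin n → ℕ
offset s zero    = 0
offset s (suc v) = s zero + offset (s ∘ suc) v

flatten : List (ℕ × ℕ) → List ℕ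
flatten = concatMap (λ { (p , q) → p ∷ q ∷ [] })

directions : ∀ κ → List (Direction κ)
directions directed   = forward ∷ []
directions undirected = forward ∷ backward ∷ []

∈-directions : ∀ {κ} (d : Direction κ) → d ∈ directions κ
∈-directions {directed}   forward  = here refl
∈-directions {undirected} forward  = here refl
∈-directions {undirected} backward = there (here refl)

directions-unique : ∀ κ → Unique (directions κ)
directions-unique directed   = [] ∷ []
directions-unique undirected = ((λ ()) ∷ []) ∷ [] ∷ []

length-directions : ∀ κ → length (directions κ) ≤ 2
length-directions directed   = s≤s z≤n
length-directions undirected = s≤s (s≤s z≤n)

-- The renaming is arbitrary, because the size bound is claimed for all of them; the machine will
-- use the one read off the incidence lists.
module Enumeration (G : Graph) (ρ : Renaming G) where
  open Graph G
  open Renaming ρ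
  open NR G ρ

  halvingAt : ∀ v → Halving (k v)
  halvingAt v = halving (k v)

  gadgetSize : Fin n → ℕ
  gadgetSize v = labels (halvingAt v) * 2

  base : Fin n → ℕ
  base = offset gadgetSize

  -- The bases in the form in which a loop over the vertices meets them, as a running sum of gadget
  -- sizes.
  Laid : ℕ → List (Fin n) → Set
  Laid b []       = ⊤
  Laid b (v ∷ vs) = base v ≡ b × Laid (b + gadgetSize v) vs

  laid : Laid 0 (allFin n)
  laid = go id 0 (λ _ → refl)
    where
    go : ∀ {l} (g : Fin l → Fin n) b → (∀ i → base (g i) ≡ b + offset (gadgetSize ∘ g) i) → Laid b (tabulate g)
    go {zero}  g b eq = tt
    go {suc l} g b eq = trans (eq zero) (+-identityʳ b) ,
      go (g ∘ suc) (b + gadgetSize (g zero)) (λ i → trans (eq (suc i)) (sym (+-assoc b _ _)))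

  gadgetVertices : Fin n → List NRVertex
  gadgetVertices v = map (v ,_) (dvertices (halvingAt v))

  vertices : List NRVertex
  vertices = concatMap gadgetVertices (allFin n)

  ∈-vertices : ∀ u → u ∈ vertices
  ∈-vertices (v , u) = ∈-concatMap-allFin gadgetVertices v (∈-map⁺ (v ,_) (∈-dvertices (halvingAt v) u))

  length-gadgetVertices : ∀ v → length (gadgetVertices v) ≡ gadgetSize v
  length-gadgetVertices v = trans (length-map (v ,_) (dvertices (halvingAt v))) (length-dvertices (halvingAt v))

  length-vertices : length vertices ≡ total gadgetSize (allFin n)
  length-vertices = trans (length-concatMap gadgetVertices (allFin n))
    (total-cong length-gadgetVertices (allFin n))

  vnum : NRVertex → ℕ
  vnum (v , u) = base v + dnum u

  vertices-consecutive : Consecutive vnum 0 vertices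
  vertices-consecutive = go 0 (allFin n) laid
    where
    go : ∀ b vs → Laid b vs → Consecutive vnum b (concatMap gadgetVertices vs)
    go b []       _          = tt
    go b (v ∷ vs) (eq , ls) = Stored-append (gadgetVertices v)
      (Stored-via (v ,_) (dvertices (halvingAt v))
        (Stored-map (dvertices (halvingAt v)) (λ i _ _ p → trans (cong (_+ _) eq) p) (dnum-consecutive (halvingAt v) b)))
      (subst (λ l → Consecutive vnum (b + l) (concatMap gadgetVertices vs)) (sym (length-gadgetVertices v))
        (go (b + gadgetSize v) vs ls))

  ν : NRVertex ↔ Fin (length vertices)
  ν = numbering vnum vertices ∈-vertices vertices-consecutive

  gadgetEdges : Fin n → List NREdge
  gadgetEdges v = map (gadget v) (dedges (halvingAt v))

  arcs : Fin m → List NREdge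
  arcs e = map (arc e) (directions kind)

  edges : List NREdge
  edges = concatMap gadgetEdges (allFin n) ++ concatMap arcs (allFin m)

  ∈-edges : ∀ e → e ∈ edges
  ∈-edges (gadget v e) = ∈-++⁺ˡ (∈-concatMap-allFin gadgetEdges v (∈-map⁺ (gadget v) (∈-dedges (halvingAt v) e)))
  ∈-edges (arc e d)    = ∈-++⁺ʳ _ (∈-concatMap-allFin arcs e (∈-map⁺ (arc e) (∈-directions d)))

  edges-unique : Unique edges
  edges-unique = Unique.++⁺
    (unique-concatMap gadgetEdges
      (λ p q → gadget-≡ (proj₂ (proj₂ (∈-map⁻ _ p))) (proj₂ (proj₂ (∈-map⁻ _ q))))
      (λ v → Unique.map⁺ (λ { refl → refl }) (dedges-unique (halvingAt v))) (allFin⁺ n))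
    (unique-concatMap arcs
      (λ p q → arc-≡ (proj₂ (proj₂ (∈-map⁻ _ p))) (proj₂ (proj₂ (∈-map⁻ _ q))))
      (λ e → Unique.map⁺ (λ { refl → refl }) (directions-unique kind)) (allFin⁺ m))
    disjoint
    where
    gadget-≡ : ∀ {v v′ y d d′} → y ≡ gadget v d → y ≡ gadget v′ d′ → v ≡ v′
    gadget-≡ refl refl = refl
    arc-≡ : ∀ {v v′ y d d′} → y ≡ arc v d → y ≡ arc v′ d′ → v ≡ v′
    arc-≡ refl refl = refl
    disjoint : ∀ {e} → e ∈ concatMap gadgetEdges (allFin n) × e ∈ concatMap arcs (allFin m) → _
    disjoint (p , q) with find (∈-concatMap⁻ gadgetEdges {xs = allFin n} p) | find (∈-concatMap⁻ arcs {xs = allFin m} q)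
    ... | _ , _ , r | _ , _ , s with ∈-map⁻ _ r | ∈-map⁻ _ s
    ... | _ , _ , refl | _ , _ , ()

  ε : NREdge ↔ Fin (length edges)
  ε = listing edges ∈-edges edges-unique

  Σk≤2m : total k (allFin n) ≤ 2 * m
  Σk≤2m = total-incidences≤ G k (λ v i → proj₁ (occurrence v i)) (λ v i → proj₁ (proj₂ (occurrence v i))) injective
    where
    occurrence : ∀ v (i : Fin (k v)) → OccursAt v (Refinement.value (Inverse.to (rename v) i))
    occurrence v i with Inverse.to (rename v) i
    -- The occurrence is stored irrelevantly; a search through the finitely many edges recovers one.
    ... | x , [ p ] = recompute (any? λ e → ((tail e ≟ᶠ v) ⊎-dec (head e ≟ᶠ v)) ×-dec (label e ≟ x)) p
    value-≡ : ∀ {v} {x y : LabelAt v} → Refinement.value x ≡ Refinement.value y → x ≡ y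
    value-≡ refl = refl
    injective : ∀ v {i j} → proj₁ (occurrence v i) ≡ proj₁ (occurrence v j) → i ≡ j
    injective v {i} {j} eq = begin
      i                                                ≡⟨ Inverse.strictlyInverseʳ (rename v) i ⟨
      Inverse.from (rename v) (Inverse.to (rename v) i) ≡⟨ cong (Inverse.from (rename v)) (value-≡ (trans (sym (proj₂ (proj₂ (occurrence v i)))) (trans (cong label eq) (proj₂ (proj₂ (occurrence v j)))))) ⟩
      Inverse.from (rename v) (Inverse.to (rename v) j) ≡⟨ Inverse.strictlyInverseʳ (rename v) j ⟩
      j                                                ∎
      where open ≡-Reasoning

  total-labels : total (labels ∘ halvingAt) (allFin n) ≤ 6 * m
  total-labels = begin
    total (labels ∘ halvingAt) (allFin n) ≤⟨ total-mono (labels≤ ∘ halvingAt) (allFin n) ⟩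
    total (λ v → 3 * k v) (allFin n)      ≡⟨ total-* 3 k (allFin n) ⟩
    3 * total k (allFin n)                ≤⟨ *-monoʳ-≤ 3 Σk≤2m ⟩
    3 * (2 * m)                           ≡⟨ *-assoc 3 2 m ⟨
    6 * m                                 ∎
    where open ≤-Reasoning

  vertices≤ : length vertices ≤ 20 * m
  vertices≤ = begin
    length vertices                                ≡⟨ length-vertices ⟩
    total gadgetSize (allFin n)                    ≡⟨ total-cong (λ v → *-comm (labels (halvingAt v)) 2) (allFin n) ⟩
    total (λ v → 2 * labels (halvingAt v)) (allFin n) ≡⟨ total-* 2 (labels ∘ halvingAt) (allFin n) ⟩
    2 * total (labels ∘ halvingAt) (allFin n)      ≤⟨ *-monoʳ-≤ 2 total-labels ⟩
    2 * (6 * m)                                    ≡⟨ *-assoc 2 6 m ⟨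
    -- 12 would do here; 20 is the constant that the edges need.
    12 * m                                         ≤⟨ *-monoˡ-≤ m (m≤m+n 12 8) ⟩
    20 * m                                         ∎
    where open ≤-Reasoning

  -- Three edges for each of at most 6m labels, counted over all levels, and at most two arcs for
  -- each edge of `G`: 18 + 2 = 20.
  edges≤ : length edges ≤ 20 * m
  edges≤ = begin
    length edges
      ≡⟨ trans (length-++ (concatMap gadgetEdges (allFin n)))
           (cong₂ _+_ (length-concatMap gadgetEdges (allFin n)) (length-concatMap arcs (allFin m))) ⟩
    total (length ∘ gadgetEdges) (allFin n) + total (length ∘ arcs) (allFin m)
      ≤⟨ +-mono-≤
           (total-mono (λ v → subst (_≤ 3 * labels (halvingAt v)) (sym (length-map (gadget v) (dedges (halvingAt v)))) (length-dedges (halvingAt v))) (allFin n))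
           (total-mono (λ e → subst (_≤ 2 * 1) (sym (length-map (arc e) (directions kind))) (length-directions kind)) (allFin m)) ⟩
    total (λ v → 3 * labels (halvingAt v)) (allFin n) + total (λ _ → 2 * 1) (allFin m)
      ≡⟨ cong₂ _+_ (total-* 3 (labels ∘ halvingAt) (allFin n)) (trans (total-* 2 (λ _ → 1) (allFin m)) (cong (2 *_) (trans (total-1 (allFin m)) (length-tabulate {n = m} id)))) ⟩
    3 * total (labels ∘ halvingAt) (allFin n) + 2 * m
      ≤⟨ +-monoˡ-≤ (2 * m) (*-monoʳ-≤ 3 total-labels) ⟩
    3 * (6 * m) + 2 * m
      ≡⟨ cong (_+ 2 * m) (*-assoc 3 6 m) ⟨
    18 * m + 2 * m
      ≡⟨ *-distribʳ-+ m 18 2 ⟨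
    20 * m ∎
    where open ≤-Reasoning

  -- Numerical form of the output

  arcPair : Fin m → ∀ {κ} → Direction κ → ℕ × ℕ
  arcPair e forward  = vnum (vertex̄ (tail e) (labelAtTail e)) , vnum (vertex (head e) (labelAtHead e))
  arcPair e backward = vnum (vertex̄ (head e) (labelAtHead e)) , vnum (vertex (tail e) (labelAtTail e))

  arcPairs : Fin m → List (ℕ × ℕ)
  arcPairs e = map (arcPair e) (directions kind)

  names : Fin m → List ℕ
  names e = vnum (vertex (tail e) (labelAtTail e)) ∷ vnum (vertex̄ (tail e) (labelAtTail e)) ∷
            vnum (vertex (head e) (labelAtHead e)) ∷ vnum (vertex̄ (head e) (labelAtHead e)) ∷ []

  gadgetPairsAt : Fin n → List (ℕ × ℕ)
  gadgetPairsAt v = gadgetPairs (halvingAt v) (base v)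

  pairs : List (ℕ × ℕ)
  pairs = concatMap gadgetPairsAt (allFin n) ++ concatMap arcPairs (allFin m)

  private
    endPair : NREdge → ℕ × ℕ
    endPair e = vnum (source e) , vnum (target e)

    endPair-arc : ∀ e d → endPair (arc e d) ≡ arcPair e d
    endPair-arc e forward  = refl
    endPair-arc e backward = refl

    map-endPair : map endPair edges ≡ pairs
    map-endPair = begin
      map endPair edges
        ≡⟨ map-++ endPair (concatMap gadgetEdges (allFin n)) _ ⟩
      map endPair (concatMap gadgetEdges (allFin n)) ++ map endPair (concatMap arcs (allFin m))
        ≡⟨ cong₂ _++_ (map-concatMap endPair gadgetEdges (allFin n)) (map-concatMap endPair arcs (allFin m)) ⟩
      concatMap (map endPair ∘ gadgetEdges) (allFin n) ++ concatMap (map endPair ∘ arcs) (allFin m)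
        ≡⟨ cong₂ _++_
             (concatMap-cong (λ v → trans (sym (map-∘ (dedges (halvingAt v)))) (ends-dedges (halvingAt v) (base v))) (allFin n))
             (concatMap-cong (λ e → trans (sym (map-∘ (directions kind))) (map-cong (endPair-arc e) (directions kind))) (allFin m)) ⟩
      pairs ∎
      where open ≡-Reasoning

    number : ∀ u → toℕ (Inverse.to ν u) ≡ vnum u
    number = toℕ-numbering vnum vertices ∈-vertices vertices-consecutive

  length-pairs : length pairs ≡ length edges
  length-pairs = trans (cong length (sym map-endPair)) (length-map endPair edges)

  encodeDigraph-≡ : encodeDigraph graph ν ε ≡ length vertices ∷ length edges ∷ flatten pairs
  encodeDigraph-≡ = cong (λ xs → length vertices ∷ length edges ∷ xs) (begin
    concatMap (λ j → block (lookup edges j)) (allFin (length edges)) ≡⟨ concatMap-lookup block edges ⟩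
    concatMap block edges ≡⟨ concatMap-cong (λ e → cong₂ (λ i j → i ∷ j ∷ []) (number (source e)) (number (target e))) edges ⟩
    concatMap (λ e → vnum (source e) ∷ vnum (target e) ∷ []) edges ≡⟨ concatMap-map _ endPair edges ⟨
    flatten (map endPair edges) ≡⟨ cong flatten map-endPair ⟩
    flatten pairs ∎)
    where
    open ≡-Reasoning
    block : NREdge → List ℕ
    block e = toℕ (Inverse.to ν (source e)) ∷ toℕ (Inverse.to ν (target e)) ∷ []

  encodeNames-≡ : encodeNames G ρ ν ≡ concatMap names (allFin m)
  encodeNames-≡ = concatMap-cong
    (λ e → cong₂ (λ i js → i ∷ js) (number _) (cong₂ (λ i js → i ∷ js) (number _)
      (cong₂ (λ i j → i ∷ j ∷ []) (number _) (number _)))) (allFin m)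

-- The distinct labels of a grouped list

-- One entry for each maximal block of equal entries; p is 0 or one more than
-- the entry in front of the list.
groups : ℕ → List ℕ → List ℕ
groups p []       = []
groups p (x ∷ xs) with suc x ≟ p
... | yes _ = groups p xs
... | no _  = x ∷ groups (suc x) xs

groups-old : ∀ {p x} xs → suc x ≡ p → groups p (x ∷ xs) ≡ groups p xs
groups-old {p} {x} xs eq with suc x ≟ p
... | yes _ = refl
... | no ¬p = contradiction eq ¬p

groups-new : ∀ {p x} xs → suc x ≢ p → groups p (x ∷ xs) ≡ x ∷ groups (suc x) xs
groups-new {p} {x} xs neq with suc x ≟ p
... | yes p = contradiction p neq
... | no _  = refl

groups-⊆ : ∀ p xs {x} → x ∈ groups p xs → x ∈ xs
groups-⊆ p (x ∷ xs) q with suc x ≟ p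
groups-⊆ p (x ∷ xs) q         | yes _ = there (groups-⊆ p xs q)
groups-⊆ p (x ∷ xs) (here eq) | no _  = here eq
groups-⊆ p (x ∷ xs) (there q) | no _  = there (groups-⊆ (suc x) xs q)

groups-⊇ : ∀ p xs {x} → x ∈ xs → suc x ≡ p ⊎ x ∈ groups p xs
groups-⊇ p (x ∷ xs) q with suc x ≟ p
groups-⊇ p (x ∷ xs) (here refl) | yes eq = inj₁ eq
groups-⊇ p (x ∷ xs) (there q)   | yes eq = groups-⊇ p xs q
groups-⊇ p (x ∷ xs) (here eq)   | no _   = inj₂ (here eq)
groups-⊇ p (x ∷ xs) (there q)   | no _ with groups-⊇ (suc x) xs q
... | inj₁ refl = inj₂ (here refl)
... | inj₂ r    = inj₂ (there r)

length-groups : ∀ p xs → length (groups p xs) ≤ length xs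
length-groups p [] = z≤n
length-groups p (x ∷ xs) with suc x ≟ p
... | yes _ = m≤n⇒m≤1+n (length-groups p xs)
... | no _  = s≤s (length-groups (suc x) xs)

Grouped-tail : ∀ {x xs} → Grouped (x ∷ xs) → Grouped xs
Grouped-tail g i j l i≤j j≤l = g (suc i) (suc j) (suc l) (s≤s i≤j) (s≤s j≤l)

-- A later x would enclose the different entry y between two equal ones.
Grouped-∉ : ∀ {x y ys} → Grouped (x ∷ y ∷ ys) → x ≢ y → x ∉ y ∷ ys
Grouped-∉ g x≢y q = x≢y (sym (g zero (suc zero) (suc (index q)) z≤n (s≤s z≤n) (lookup-index q)))

-- The leading x is the block in progress. Repetitions next to it are skipped by `groups`, and once
-- another entry has come grouping excludes x for good.
groups-unique⁺ : ∀ x xs → Grouped (x ∷ xs) → Unique (x ∷ groups (suc x) xs)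
groups-unique⁺ x [] g = [] ∷ []
groups-unique⁺ x (y ∷ ys) g with suc y ≟ suc x
... | yes refl = groups-unique⁺ y ys (Grouped-tail g)
... | no y≢x = ¬Any⇒All¬ _ (λ q → Grouped-∉ g (λ { refl → y≢x refl }) (inflate q)) ∷
               groups-unique⁺ y ys (Grouped-tail g)
  where
  inflate : x ∈ y ∷ groups (suc y) ys → x ∈ y ∷ ys
  inflate (here eq) = here eq
  inflate (there q) = there (groups-⊆ (suc y) ys q)

groups-unique : ∀ xs → Grouped xs → Unique (groups 0 xs)
groups-unique []       g = []
groups-unique (x ∷ xs) g = groups-unique⁺ x xs g

-- The renaming read off the grouped incidence lists

module GroupedLabels (G : Graph) (I : GroupedIncidence G) where
  open Graph G
  open GroupedIncidence I

  labelsAt : Fin n → List ℕ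
  labelsAt v = groups 0 (map label (edgesAt v))

  private
    occurs : ∀ v {x} → x ∈ labelsAt v → OccursAt v x
    occurs v q with ∈-map⁻ label (groups-⊆ 0 (map label (edgesAt v)) q)
    ... | e , e∈ , eq = e , Equivalence.to (complete v e) e∈ , sym eq

    member : ∀ v {x} → OccursAt v x → x ∈ labelsAt v
    member v (e , inc , refl) with groups-⊇ 0 (map label (edgesAt v)) (∈-map⁺ label (Equivalence.from (complete v e) inc))
    ... | inj₂ q = q

    labelsAt-unique : ∀ v → Unique (labelsAt v)
    labelsAt-unique v = groups-unique (map label (edgesAt v)) (grouped v)

    locate : ∀ v (x : LabelAt v) → value x ∈ labelsAt v
    locate v (x , [ p ]) = recompute (_∈?_ _≟_ x (labelsAt v)) (member v p)

    entry : ∀ v → Fin (length (labelsAt v)) → LabelAt v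
    entry v i = lookup (labelsAt v) i , [ occurs v (∈-lookup {xs = labelsAt v} i) ]

    value-≡ : ∀ {v} {x y : LabelAt v} → value x ≡ value y → x ≡ y
    value-≡ refl = refl

  -- The labels at v are numbered in the order in which the scan meets their groups. The gadgets
  -- that the program builds are those of this renaming.
  renamingOf : Renaming G
  renamingOf = record
    { k = length ∘ labelsAt
    ; rename = λ v → mk↔ₛ′
        (entry v)
        (index ∘ locate v)
        (λ x → value-≡ (sym (lookup-index (locate v x))))
        (λ i → lookup-injective (labelsAt-unique v) (sym (lookup-index (locate v (entry v i)))))
    }

  -- The scan knows a position that carries the right label; uniqueness of the labels identifies it
  -- with the number under the renaming.
  rename-from : ∀ v (x : LabelAt v) i → lookup (labelsAt v) i ≡ value x →
                Inverse.from (Renaming.rename renamingOf v) x ≡ i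
  rename-from v x i eq = lookup-injective (labelsAt-unique v) (trans (sym (lookup-index (locate v x))) (sym eq))

  degree : Fin n → ℕ
  degree v = length (edgesAt v)

  total-degree : total degree (allFin n) ≤ 2 * m
  total-degree = total-incidences≤ G degree (λ v → lookup (edgesAt v))
    (λ v i → Equivalence.to (complete v _) (∈-lookup {xs = edgesAt v} i))
    (λ v → lookup-injective (unique v))

  -- Lets the constant cost of a visit be charged to the degree, which turns a bound in n and m into
  -- one in m.
  degree≥1 : ∀ v → 1 ≤ degree v
  degree≥1 v with nonisolated v
  ... | e , inc with edgesAt v | Equivalence.from (complete v e) inc
  ... | _ ∷ _ | _ = s≤s z≤n

  labelsAt≤degree : ∀ v → length (labelsAt v) ≤ degree v
  labelsAt≤degree v = ≤-trans (length-groups 0 (map label (edgesAt v))) (≤-reflexive (length-map label (edgesAt v)))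

-- Registers, and the emission of one gadget

$A $B $one $three $n $ptr $v $b $q $count $len $k $prev $e $addr $tail $head $label $diff : ℕ
-- Registers 0 and 1 are where `Represents-nr` expects the pointers to the graph and to the names.
$A = 0
$B = 1
$one = 2
$three = 3
$n = 4
$ptr = 5
$v = 6
$b = 7
$q = 8
$count = 9
$len = 10
$k = 11
$prev = 12
$e = 13
$addr = 14
$tail = 15
$head = 16
$label = 17
$diff = 18

$plain $barred $name₀ $name₁ $name₂ $name₃ $kind $m $rest $z $u $x $x₁ $x₂ $x₃ $y $y₁ $tmp : ℕ
$plain = 19
$barred = 20
$name₀ = 21
$name₁ = 22
$name₂ = 23
$name₃ = 24
$kind = 25
$m = 26
$rest = 27
$z = 28
$u = 29
$x = 30
$x₁ = 31
$x₂ = 32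
$x₃ = 33
$y = 34
$y₁ = 35
$tmp = 36

emit : ℕ × ℕ → Cmd
emit (x , y) = ops (store $q x ∷ add $q $q $one ∷ store $q y ∷ add $q $q $one ∷ add $count $count $one ∷ [])

emits : List (ℕ × ℕ) → Cmd
emits []         = ops []
emits (xy ∷ xys) = emit xy ⨟ emits xys

levelBody : Cmd
levelBody =
  ops (add $x₁ $one $x ∷ add $x₂ $one $x₁ ∷ add $x₃ $one $x₂ ∷ add $y₁ $one $y ∷
       sub $rest $rest $one ∷ []) ⨟
  ifz $rest
    (emits (($x , $y) ∷ ($y₁ , $x₁) ∷ []))
    (emits (($x , $x₃) ∷ ($x , $y) ∷ ($y₁ , $x₁) ∷ ($x₂ , $x₁) ∷ ($x₂ , $y) ∷ ($y₁ , $x₃) ∷ [])) ⨟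
  -- After a single last label `$rest` is already 0, and truncated subtraction keeps it there. `$z`
  -- counts the rounds, which number ⌈k/2⌉.
  ops (sub $rest $rest $one ∷ add $x $one $x₃ ∷ add $y $one $y₁ ∷ add $z $one $z ∷ [])

gadgetBody : Cmd
gadgetBody =
  -- Adding a zero register serves as a move instruction. `$y` and the new `$b` are b + 2k, where D′
  -- begins.
  ops (const $z 0 ∷ add $rest $k $z ∷ add $x $b $z ∷ add $y $b $k ∷ add $y $y $k ∷ add $b $y $z ∷ []) ⨟
  while $rest levelBody ⨟
  ops (const $tmp 0 ∷ add $k $z $tmp ∷ sub $u $k $one ∷ sub $u $u $one ∷ [])

gadgetCode : Cmd
gadgetCode =
  ops (sub $u $k $one ∷ sub $u $u $one ∷ []) ⨟
  while $u gadgetBody ⨟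
  -- Now k ≤ 2, so k ∸ 1 is nonzero exactly for D 2, the only small gadget with edges.
  ops (sub $u $k $one ∷ add $x₁ $one $b ∷ add $x₂ $one $x₁ ∷ add $x₃ $one $x₂ ∷ []) ⨟
  ifz $u (ops []) (emits (($b , $x₃) ∷ ($x₂ , $x₁) ∷ [])) ⨟
  -- Moves `$b` past the labelled vertices of the innermost copy, to the base of the next gadget.
  ops (add $b $b $k ∷ add $b $b $k ∷ [])

-- Total correctness with step bounds

-- T is the intended final content of the memory.  Cells are only ever written
-- with their final values, so a cell that is right stays right.
module Machine (T : ℕ → ℕ) where

  infix 4 _⊑_
  record _⊑_ (M M′ : ℕ → ℕ) : Set where
    constructor mk⊑
    field stays : ∀ a → M a ≡ T a → M′ a ≡ T a
  open _⊑_ public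

  ⊑-refl : ∀ {M} → M ⊑ M
  ⊑-refl = mk⊑ λ _ p → p

  ⊑-trans : ∀ {L M N} → L ⊑ M → M ⊑ N → L ⊑ N
  ⊑-trans p q = mk⊑ λ a eq → stays q a (stays p a eq)

  ≔-same : ∀ (M : ℕ → ℕ) a x → (M [ a ≔ x ]) a ≡ x
  ≔-same M a x with a ≡ᵇ a | ≡⇒≡ᵇ a a refl
  ... | true | _ = refl

  -- At `a` itself the new value is the final one, and all other cells are unchanged. Thus overlap
  -- between the areas of memory is never discussed.
  ⊑-≔ : ∀ {M a x} → T a ≡ x → M ⊑ M [ a ≔ x ]
  ⊑-≔ {M} {a} {x} eq = mk⊑ go
    where
    go : ∀ i → M i ≡ T i → (M [ a ≔ x ]) i ≡ T i
    go i p with i ≡ᵇ a in i≡a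
    ... | true  = trans (sym eq) (cong T (sym (≡ᵇ⇒≡ i a (subst IsTrue (sym i≡a) tt))))
    ... | false = p

  writes : ∀ {M a b x y} → T a ≡ x → T b ≡ y → let M′ = (M [ a ≔ x ]) [ b ≔ y ] in
           M ⊑ M′ × M′ a ≡ T a × M′ b ≡ T b
  writes {M} {a} {b} {x} {y} p q = ⊑-trans (⊑-≔ {M} p) grow ,
    stays grow a (trans (≔-same M a x) (sym p)) , trans (≔-same (M [ a ≔ x ]) b y) (sym q)
    where
    grow : M [ a ≔ x ] ⊑ (M [ a ≔ x ]) [ b ≔ y ]
    grow = ⊑-≔ q

  -- A Hoare triple for total correctness with a bound on the time. The growth of memory is built
  -- in, so that every rule passes it on.
  record Run (c : Cmd) (s : Store) (bound : ℕ) (Q : Store → Set) : Set where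
    constructor mkRun
    field
      {final} : Store
      {time}  : ℕ
      steps   : Exec c s time final
      fast    : time ≤ bound
      grow    : cells s ⊑ cells final
      post    : Q final

  run-ops : ∀ {s Q} os → cells s ⊑ cells (run os s) → Q (run os s) → Run (ops os) s (length os) Q
  run-ops os g q = mkRun ops ≤-refl g q

  -- The continuation also receives the execution of `c`: through `kept` it yields the registers
  -- that `Q` does not mention.
  run-⨟ : ∀ {c d s i j Q Q′} → Run c s i Q →
          (∀ {s′ t} → Exec c s t s′ → cells s ⊑ cells s′ → Q s′ → Run d s′ j Q′) →
          Run (c ⨟ d) s (i + j) Q′
  run-⨟ (mkRun x f g q) k with k x g q
  ... | mkRun x′ f′ g′ q′ = mkRun (x ⨟ x′) (+-mono-≤ f f′) (⊑-trans g g′) q′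

  assign : ∀ {os d s j Q} → cells s ⊑ cells (run os s) → Run d (run os s) j Q →
           Run (ops os ⨟ d) s (length os + j) Q
  assign g (mkRun x f g′ q) = mkRun (ops ⨟ x) (+-monoʳ-≤ _ f) (⊑-trans g g′) q

  run-ifz : ∀ {r c d s i Q} → (regs s r ≡ 0 → Run c s i Q) → (∀ {j} → regs s r ≡ suc j → Run d s i Q) →
            Run (ifz r c d) s (2 + i) Q
  run-ifz {r} {c} {d} {s} {i} {Q} p q = go (regs s r) refl
    where
    go : ∀ j → regs s r ≡ j → Run (ifz r c d) s (2 + i) Q
    go zero    eq with p eq
    ... | mkRun x f g z = mkRun (ifz-zero eq x) (m≤n⇒m≤1+n (s≤s f)) g z
    go (suc j) eq with q eq
    ... | mkRun {time = t} x f g z = mkRun (ifz-suc eq x) (s≤s (subst (_≤ suc i) (+-comm 1 t) (s≤s f))) g z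

  run-stop : ∀ {r c s Q} → regs s r ≡ 0 → Q s → Run (while r c) s 1 Q
  run-stop eq q = mkRun (while-zero eq) ≤-refl ⊑-refl q

  run-loop : ∀ {r c s i j l Q Q′} → regs s r ≡ suc l → Run c s i Q →
             (∀ {s′ t} → Exec c s t s′ → cells s ⊑ cells s′ → Q s′ → Run (while r c) s′ j Q′) →
             Run (while r c) s (2 + (i + j)) Q′
  run-loop {i = i} {j} eq (mkRun {time = t} x f g q) k with k x g q
  ... | mkRun {time = t′} x′ f′ g′ q′ = mkRun (while-suc eq x x′)
    (s≤s (subst (_≤ suc (i + j)) (sym (+-suc t t′)) (s≤s (+-mono-≤ f f′)))) (⊑-trans g g′) q′

  weaken : ∀ {c s i j Q} → i ≤ j → Run c s i Q → Run c s j Q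
  weaken i≤j (mkRun x f g q) = mkRun x (≤-trans f i≤j) g q

  -- The cells from `start` up to q are final, the pairs ps are still to be
  -- written from q on, and c pairs have been written.
  module Output (start stop E : ℕ) where

    record Pending (q c : ℕ) (M : ℕ → ℕ) (ps : List (ℕ × ℕ)) : Set where
      constructor pending
      field
        planned : Stored (λ a x → T a ≡ x) q (flatten ps)
        reaches : q + length (flatten ps) ≡ stop
        counted : c + length ps ≡ E
        written : ∀ a → start ≤ a → a < q → M a ≡ T a
    open Pending public

    Out : Store → List (ℕ × ℕ) → Set
    Out s = Pending (regs s $q) (regs s $count) (cells s)

    Out-grow : ∀ {s s′ ps} → regs s′ $q ≡ regs s $q → regs s′ $count ≡ regs s $count →
               cells s ⊑ cells s′ → Out s ps → Out s′ ps
    Out-grow {ps = ps} q c g (pending p r n w) = pending (subst (λ q → Stored (λ a x → T a ≡ x) q (flatten ps)) (sym q) p)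
      (trans (cong (_+ _) q) r)
      (trans (cong (_+ _) c) n) (λ a l u → stays g a (w a l (subst (a <_) q u)))

    write : ∀ {q o c M p p′ ps x y} → o ≡ 1 → x ≡ p → y ≡ p′ → Pending q c M ((p , p′) ∷ ps) →
            Pending (q + o + o) (c + o) ((M [ q ≔ x ]) [ q + o ≔ y ]) ps ×
            M ⊑ (M [ q ≔ x ]) [ q + o ≔ y ]
    write {q} {c = c} {M} {ps = rest} {x = x} {y} refl refl refl (pending (p₀ , p₁ , ps) r n w) =
      pending (subst (λ i → Stored (λ a x → T a ≡ x) i (flatten rest)) (trans (cong suc (+-comm 1 q)) (+-comm 1 (q + 1))) ps)
        (trans (shift q (length (flatten rest))) r) (trans (+-assoc c 1 _) n) full , grow
      where
      shift : ∀ q l → q + 1 + 1 + l ≡ q + (2 + l)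
      shift = solve-∀
      p₁′ : T (q + 1) ≡ y
      p₁′ = subst (λ i → T i ≡ y) (+-comm 1 q) p₁
      grow₀ : M ⊑ M [ q ≔ x ]
      grow₀ = ⊑-≔ p₀
      grow₁ : M [ q ≔ x ] ⊑ (M [ q ≔ x ]) [ q + 1 ≔ y ]
      grow₁ = ⊑-≔ p₁′
      grow = ⊑-trans grow₀ grow₁
      M′ = (M [ q ≔ x ]) [ q + 1 ≔ y ]
      full : ∀ a → start ≤ a → a < q + 1 + 1 → M′ a ≡ T a
      full a l u with a ≟ q + 1
      ... | yes refl = trans (≔-same (M [ q ≔ x ]) a y) (sym p₁′)
      ... | no a≢q+1 with a ≟ q
      ... | yes refl = stays grow₁ a (trans (≔-same M a x) (sym p₀))
      ... | no a≢q = stays grow a (w a l (≤∧≢⇒< (s≤s⁻¹ (subst (a <_) (+-comm q 1) (≤∧≢⇒< (s≤s⁻¹ (subst (a <_) (+-comm (q + 1) 1) u)) a≢q+1))) a≢q))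

    values : Store → ℕ × ℕ → ℕ × ℕ
    values s (x , y) = regs s x , regs s y

    -- Which registers `emit` changes does not depend on the pair that it emits, hence the
    -- placeholder.
    Settled : ℕ × ℕ → Set
    Settled (x , y) = keeps x (emit (0 , 0)) ≡ true × keeps y (emit (0 , 0)) ≡ true

    run-emits : ∀ {xys s ps qs} → All Settled xys → regs s $one ≡ 1 → map (values s) xys ≡ qs →
                Out s (qs ++ ps) → Run (emits xys) s (length xys * 5) (λ s′ → Out s′ ps)
    run-emits {[]} [] one≡ refl out = run-ops [] ⊑-refl out
    run-emits {(x , y) ∷ xys} {s} {ps} ((px , py) ∷ settled) one≡ refl out =
      run-⨟ (mkRun ops ≤-refl (proj₂ w) (proj₁ w)) λ x′ _ out′ →
        run-emits settled (trans (kept x′ $one refl) one≡) (same x′ settled) out′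
      where
      -- The second register is read after `$q` has moved.
      y≡ : regs (run (store $q x ∷ add $q $q $one ∷ []) s) y ≡ regs s y
      y≡ = kept {s = s} (ops {os = store $q x ∷ add $q $q $one ∷ []}) y (keep-y py)
        where
        keep-y : keeps y (emit (0 , 0)) ≡ true → keeps y (ops (store $q x ∷ add $q $q $one ∷ [])) ≡ true
        keep-y p with y ≡ᵇ $q
        ... | false = refl
      w = write {ps = map (values s) xys ++ ps} one≡ refl y≡ out
      same : ∀ {s′ t xys} → Exec (emit (x , y)) s t s′ → All Settled xys → map (values s′) xys ≡ map (values s) xys
      same x′ [] = refl
      same x′ ((p , q) ∷ ps) = cong₂ _∷_ (cong₂ _,_ (kept x′ _ p) (kept x′ _ q)) (same x′ ps)

    -- A round takes at most 43 steps, test and jump included, and uses up at least one label. The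
    -- final `$z` is the number of labels of the next level.
    levelLoop : ∀ r {x y} s {ps} → regs s $one ≡ 1 → regs s $rest ≡ r → regs s $x ≡ x → regs s $y ≡ y →
                Out s (levelPairs x y r ++ ps) →
                Run (while $rest levelBody) s (1 + r * 50)
                  (λ s′ → Out s′ ps × regs s′ $z ≡ ⌈ r /2⌉ + regs s $z)
    levelLoop 0 s one≡ rest≡ x≡ y≡ out = run-stop rest≡ (out , refl)
    levelLoop 1 s {ps} one≡ rest≡ x≡ y≡ out = weaken (m≤m+n 44 7)
      (run-loop {Q = λ s′ → Out s′ ps × regs s′ $rest ≡ 0 × regs s′ $z ≡ 1 + regs s $z} rest≡
        (assign ⊑-refl (run-⨟
          (run-ifz
            (λ _ → weaken (m≤m+n 10 20) (run-emits ((refl , refl) ∷ (refl , refl) ∷ []) one≡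
              (cong₂ (λ p q → p ∷ q ∷ []) (cong₂ _,_ x≡ y≡) (cong₂ _,_ (cong₂ _+_ one≡ y≡) (cong₂ _+_ one≡ x≡)))
              out))
            (λ eq → contradiction (trans (sym eq) (cong₂ _∸_ rest≡ one≡)) λ ()))
          λ x′ _ out′ → run-ops _ ⊑-refl
            (out′ ,
             cong₂ _∸_ (trans (kept x′ $rest refl) (cong₂ _∸_ rest≡ one≡)) (trans (kept x′ $one refl) one≡) ,
             cong₂ _+_ (trans (kept x′ $one refl) one≡) (kept x′ $z refl))))
        λ { _ _ (out′ , rest′ , z′) → run-stop rest′ (out′ , z′) })
    levelLoop (suc (suc r)) {x} {y} s {ps} one≡ rest≡ x≡ y≡ out = weaken (+-monoˡ-≤ (r * 50) (m≤m+n 44 57))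
      (run-loop {Q = λ s′ → Out s′ (levelPairs (4 + x) (2 + y) r ++ ps) × regs s′ $rest ≡ r ×
                  regs s′ $x ≡ 4 + x × regs s′ $y ≡ 2 + y × regs s′ $z ≡ 1 + regs s $z} rest≡
        (assign ⊑-refl (run-⨟
          (run-ifz
            (λ eq → contradiction (trans (sym eq) (cong₂ _∸_ rest≡ one≡)) λ ())
            (λ _ → run-emits ((refl , refl) ∷ (refl , refl) ∷ (refl , refl) ∷ (refl , refl) ∷ (refl , refl) ∷ (refl , refl) ∷ [])
              one≡
              (cong₂ _∷_ (cong₂ _,_ x≡ x₃) (cong₂ _∷_ (cong₂ _,_ x≡ y≡) (cong₂ _∷_ (cong₂ _,_ y₁ x₁)
                (cong₂ _∷_ (cong₂ _,_ x₂ x₁) (cong₂ _∷_ (cong₂ _,_ x₂ y≡) (cong₂ _∷_ (cong₂ _,_ y₁ x₃) refl))))))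
              out))
          λ x′ _ out′ → run-ops _ ⊑-refl
            (out′ ,
             cong₂ _∸_ (trans (kept x′ $rest refl) (cong₂ _∸_ rest≡ one≡)) (trans (kept x′ $one refl) one≡) ,
             cong₂ _+_ (trans (kept x′ $one refl) one≡) (trans (kept x′ $x₃ refl) x₃) ,
             cong₂ _+_ (trans (kept x′ $one refl) one≡) (trans (kept x′ $y₁ refl) y₁) ,
             cong₂ _+_ (trans (kept x′ $one refl) one≡) (kept x′ $z refl))))
        λ { {s′} x′ _ (out′ , rest′ , x′≡ , y′≡ , z′) →
          let mkRun e f g (out″ , z″) = levelLoop r s′ (trans (kept x′ $one refl) one≡) rest′ x′≡ y′≡ out′
          in mkRun e f g (out″ , trans z″ (trans (cong (⌈ r /2⌉ +_) z′) (+-suc ⌈ r /2⌉ (regs s $z)))) })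
      where
      x₁ = cong₂ _+_ one≡ x≡
      x₂ = cong₂ _+_ one≡ x₁
      x₃ = cong₂ _+_ one≡ x₂
      y₁ = cong₂ _+_ one≡ y≡

    -- The state after the levels with at least three labels.
    record Small (target : ℕ) (ps : List (ℕ × ℕ)) (s : Store) : Set where
      constructor small
      field
        {k′ b′}  : ℕ
        h        : Halving k′
        k′≤2     : k′ ≤ 2
        k≡       : regs s $k ≡ k′
        b≡       : regs s $b ≡ b′
        target≡  : b′ + k′ * 2 ≡ target
        out      : Out s (gadgetPairs h b′ ++ ps)

    private
      small-labels : ∀ {k} (h : Halving k) {b s ps} → k ≤ 2 → regs s $k ≡ k → regs s $b ≡ b →
                     Out s (gadgetPairs h b ++ ps) → Small (b + labels h * 2) ps s
      small-labels zero k≤2 k≡ b≡ out = small zero k≤2 k≡ b≡ refl out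
      small-labels one  k≤2 k≡ b≡ out = small one k≤2 k≡ b≡ refl out
      small-labels two  k≤2 k≡ b≡ out = small two k≤2 k≡ b≡ refl out
      small-labels (half h) (s≤s (s≤s ())) k≡ b≡ out

      stopped : ∀ {k} (h : Halving k) {b s ps} → k ≤ 2 → regs s $u ≡ k ∸ 1 ∸ 1 → regs s $k ≡ k → regs s $b ≡ b →
             Out s (gadgetPairs h b ++ ps) →
             Run (while $u gadgetBody) s (1 + labels h * 60) (Small (b + labels h * 2) ps)
      stopped {k} h k≤2 u≡ k≡ b≡ out = weaken (m≤m+n 1 _)
        (run-stop (trans u≡ (trans (∸-+-assoc k 1 1) (m≤n⇒m∸n≡0 k≤2))) (small-labels h k≤2 k≡ b≡ out))

      ≤-by : ∀ {i} d {j} → i + d ≡ j → i ≤ j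
      ≤-by {i} d eq = ≤-trans (m≤m+n i d) (≤-reflexive eq)

      -- Besides 50 steps per label, a level costs 13 more; with at least three labels, 10 further
      -- steps per label cover them.
      level-cost : ∀ k l → 2 + (6 + ((1 + (3 + k) * 50) + 4) + (1 + l * 60)) + (17 + k * 10) ≡ 1 + (3 + k + l) * 60
      level-cost = solve-∀

    gadgetLoop : ∀ {k} (h : Halving k) {b} s {ps} → regs s $one ≡ 1 → regs s $u ≡ k ∸ 1 ∸ 1 →
                 regs s $k ≡ k → regs s $b ≡ b → Out s (gadgetPairs h b ++ ps) →
                 Run (while $u gadgetBody) s (1 + labels h * 60) (Small (b + labels h * 2) ps)
    gadgetLoop zero s one≡ u≡ k≡ b≡ out = stopped zero z≤n u≡ k≡ b≡ out
    gadgetLoop one  s one≡ u≡ k≡ b≡ out = stopped one (s≤s z≤n) u≡ k≡ b≡ out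
    gadgetLoop two  s one≡ u≡ k≡ b≡ out = stopped two (s≤s (s≤s z≤n)) u≡ k≡ b≡ out
    gadgetLoop (half {k} h) {b} s {ps} one≡ u≡ k≡ b≡ out = weaken (≤-by (17 + k * 10) (level-cost k (labels h)))
      (run-loop {Q = λ s′ → Out s′ (gadgetPairs h (b + K * 2) ++ ps) × regs s′ $k ≡ ⌈ K /2⌉ ×
                  regs s′ $u ≡ ⌈ K /2⌉ ∸ 1 ∸ 1 × regs s′ $b ≡ b + K * 2} u≡
        (assign ⊑-refl (run-⨟
          (levelLoop K _ {gadgetPairs h (b + K * 2) ++ ps} one≡ (trans (+-identityʳ _) k≡) (trans (+-identityʳ _) b≡) y≡
            (subst (Out s) (++-assoc (levelPairs b (b + K * 2) K) _ ps) out))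
          λ { x′ _ (out′ , z≡) →
            let k′≡ = trans (+-identityʳ _) (trans z≡ (+-identityʳ ⌈ K /2⌉))
                one≡′ = trans (kept x′ $one refl) one≡
            in run-ops _ ⊑-refl
              (out′ , k′≡ , cong₂ _∸_ (cong₂ _∸_ k′≡ one≡′) one≡′ ,
               trans (kept x′ $b refl) (trans (+-identityʳ _) y≡)) }))
        λ { {s′} x′ _ (out′ , k′≡ , u′≡ , b′≡) →
          let mkRun {fin} e f g p = gadgetLoop h s′ (trans (kept x′ $one refl) one≡) u′≡ k′≡ b′≡ out′
          in mkRun e f g (subst (λ t → Small t ps fin) (end b K (labels h)) p) })
      where
      K = 3 + k
      end : ∀ b k l → b + k * 2 + l * 2 ≡ b + (k + l) * 2
      end = solve-∀
      y≡ : regs s $b + regs s $k + regs s $k ≡ b + K * 2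
      y≡ = trans (cong₂ (λ b k → b + k + k) b≡ k≡) (+-double b K)

    gadgetRun : ∀ {k} (h : Halving k) {b} s {ps} → regs s $one ≡ 1 → regs s $k ≡ k → regs s $b ≡ b →
                Out s (gadgetPairs h b ++ ps) →
                Run gadgetCode s (21 + labels h * 60) (λ s′ → Out s′ ps × regs s′ $b ≡ b + labels h * 2)
    gadgetRun h {b} s {ps} one≡ k≡ b≡ out = weaken (≤-reflexive (cost (labels h)))
      (assign ⊑-refl (run-⨟
        (gadgetLoop h _ {ps} one≡ (cong₂ _∸_ (cong₂ _∸_ k≡ one≡) one≡) k≡ b≡ out)
        λ x′ _ end → assign ⊑-refl (rest (trans (kept x′ $one refl) one≡) end)))
      where
      cost : ∀ l → 2 + ((1 + l * 60) + (4 + (2 + 10 + 2))) ≡ 21 + l * 60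
      cost = solve-∀
      rest : ∀ {s} → regs s $one ≡ 1 → Small (b + labels h * 2) ps s →
             Run (ifz $u (ops []) (emits (($b , $x₃) ∷ ($x₂ , $x₁) ∷ [])) ⨟ ops (add $b $b $k ∷ add $b $b $k ∷ []))
               (run (sub $u $k $one ∷ add $x₁ $one $b ∷ add $x₂ $one $x₁ ∷ add $x₃ $one $x₂ ∷ []) s)
               (2 + 10 + 2) (λ s′ → Out s′ ps × regs s′ $b ≡ b + labels h * 2)
      rest {s} one≡ (small {k′} {b′} h′ k′≤2 k≡ b≡ target≡ out) = run-⨟ (run-ifz (last₀ h′ k≡ out) (last h′ k′≤2 k≡ b≡ out))
        λ x′ _ out′ → run-ops _ ⊑-refl
          (out′ , trans (cong₂ (λ b k → b + k + k) (trans (kept x′ $b refl) b≡) (trans (kept x′ $k refl) k≡)) (trans (+-double b′ k′) target≡))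
        where
        s′ = run (sub $u $k $one ∷ add $x₁ $one $b ∷ add $x₂ $one $x₁ ∷ add $x₃ $one $x₂ ∷ []) s
        last₀ : ∀ {k b} (h : Halving k) → regs s $k ≡ k → Out s (gadgetPairs h b ++ ps) →
                regs s′ $u ≡ 0 → Run (ops []) s′ 10 (λ s′ → Out s′ ps)
        last₀ zero     k≡ out _  = weaken z≤n (run-ops [] ⊑-refl out)
        last₀ one      k≡ out _  = weaken z≤n (run-ops [] ⊑-refl out)
        last₀ two      k≡ out u≡ = contradiction (trans (sym u≡) (cong₂ _∸_ k≡ one≡)) λ ()
        last₀ (half h) k≡ out u≡ = contradiction (trans (sym u≡) (cong₂ _∸_ k≡ one≡)) λ ()
        last : ∀ {k b} (h : Halving k) → k ≤ 2 → regs s $k ≡ k → regs s $b ≡ b → Out s (gadgetPairs h b ++ ps) →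
               ∀ {j} → regs s′ $u ≡ suc j → Run (emits (($b , $x₃) ∷ ($x₂ , $x₁) ∷ [])) s′ 10 (λ s′ → Out s′ ps)
        last zero _ k≡ b≡ out u≡ = contradiction (trans (sym u≡) (cong₂ _∸_ k≡ one≡)) λ ()
        last one  _ k≡ b≡ out u≡ = contradiction (trans (sym u≡) (cong₂ _∸_ k≡ one≡)) λ ()
        last two  _ k≡ b≡ out u≡ = run-emits ((refl , refl) ∷ (refl , refl) ∷ []) one≡
          (cong₂ _∷_ (cong₂ _,_ b≡ x₃) (cong₂ (λ p q → (p , q) ∷ []) x₂ x₁)) out
          where
          x₁ = cong₂ _+_ one≡ b≡
          x₂ = cong₂ _+_ one≡ x₁
          x₃ = cong₂ _+_ one≡ x₂
        last (half h) (s≤s (s≤s ()))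

-- The complete program

difference : ℕ → ℕ → List Op
-- One of the two truncated differences is 0, so `$diff` is the distance of the values and `jzero`
-- on it tests equality.
difference x y = sub $diff x y ∷ sub $tmp y x ∷ add $diff $diff $tmp ∷ []

-- $prev is one more than the preceding label, and 0 at the start of a list.
scanBody : Cmd
scanBody =
  ops (load $e $ptr ∷ add $ptr $ptr $one ∷
       -- The row of edge e starts at cell 3 + 3e, behind the three header cells.
       add $addr $e $e ∷ add $addr $addr $e ∷ add $addr $three $addr ∷ load $tail $addr ∷
       add $addr $one $addr ∷ load $head $addr ∷ add $addr $one $addr ∷ load $label $addr ∷
       add $label $one $label ∷ difference $label $prev) ⨟
  ifz $diff (ops [])
    -- A new group gets the next free number `$k`, hence the vertex b + 2k. Within a group `$plain`
    -- keeps its value.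
    (ops (add $plain $b $k ∷ add $plain $plain $k ∷ const $tmp 0 ∷ add $prev $label $tmp ∷ add $k $k $one ∷ [])) ⨟
  ops (add $barred $one $plain ∷ add $name₀ $e $e ∷ add $name₀ $name₀ $name₀ ∷ add $name₀ $B $name₀ ∷
       add $name₁ $one $name₀ ∷ add $name₂ $one $name₁ ∷ add $name₃ $one $name₂ ∷ difference $tail $v) ⨟
  -- The entry of e has one half for each end. The visit to v fills in the halves that belong to v,
  -- both of them for a loop.
  ifz $diff (ops (store $name₀ $plain ∷ store $name₁ $barred ∷ [])) (ops []) ⨟
  ops (difference $head $v) ⨟
  ifz $diff (ops (store $name₂ $plain ∷ store $name₃ $barred ∷ [])) (ops []) ⨟
  ops (sub $len $len $one ∷ [])

vertexBody : Cmd
vertexBody =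
  ops (load $len $ptr ∷ add $ptr $ptr $one ∷ const $k 0 ∷ const $prev 0 ∷ []) ⨟
  while $len scanBody ⨟
  gadgetCode ⨟
  ops (add $v $v $one ∷ sub $n $n $one ∷ [])

arcBody : Cmd
arcBody =
  ops (load $x $name₀ ∷ add $name₀ $one $name₀ ∷ load $x₁ $name₀ ∷ add $name₀ $one $name₀ ∷
       load $x₂ $name₀ ∷ add $name₀ $one $name₀ ∷ load $x₃ $name₀ ∷ add $name₀ $one $name₀ ∷ []) ⨟
  emits (($x₁ , $x₂) ∷ []) ⨟
  ifz $kind (ops []) (emits (($x₃ , $x) ∷ [])) ⨟
  ops (sub $m $m $one ∷ [])

main : Cmd
main =
  ops (const $one 1 ∷ const $three 3 ∷ const $tmp 0 ∷ load $kind $tmp ∷ load $n $one ∷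
       add $tmp $one $one ∷ load $m $tmp ∷ []) ⨟
  -- The incidence lists begin behind the 3m cells of the edge table. `$B` must be found without
  -- reading the input to its end, so it is a bound on the input length computed from n and m.
  ops (add $ptr $m $m ∷ add $ptr $ptr $m ∷ add $ptr $three $ptr ∷
       add $B $ptr $n ∷ add $B $B $m ∷ add $B $B $m ∷ []) ⨟
  -- The names take 4m cells. `$q` starts two cells behind `$A`, because the numbers of vertices and
  -- edges are not known yet.
  ops (add $A $B $m ∷ add $A $A $m ∷ add $A $A $m ∷ add $A $A $m ∷
       add $q $one $A ∷ add $q $one $q ∷ []) ⨟
  while $n vertexBody ⨟
  ops (const $tmp 0 ∷ add $name₀ $B $tmp ∷ []) ⨟
  while $m arcBody ⨟
  -- The two counts can be stored now: `$b` has run past all gadgets and so equals the number of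
  -- vertices.
  ops (add $tmp $one $A ∷ store $A $b ∷ store $tmp $count ∷ [])

-- Verification of the program

private
  difference-zero : ∀ a b → (a ∸ b) + (b ∸ a) ≡ 0 → a ≡ b
  difference-zero a b eq = ≤-antisym (m∸n≡0⇒m≤n (m+n≡0⇒m≡0 (a ∸ b) eq)) (m∸n≡0⇒m≤n (m+n≡0⇒n≡0 (a ∸ b) eq))

  difference-suc : ∀ {a b j} → (a ∸ b) + (b ∸ a) ≡ suc j → a ≢ b
  difference-suc {a} eq refl = contradiction (trans (sym eq) (cong (λ d → d + d) (n∸n≡0 a))) λ ()

  lookup-middle : ∀ (xs : List ℕ) x ys {zs} → zs ≡ xs ++ x ∷ ys → ∃ λ i → lookup zs i ≡ x × toℕ i ≡ length xs
  lookup-middle []       x ys refl = zero , refl , refl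
  lookup-middle (y ∷ xs) x ys refl with lookup-middle xs x ys refl
  ... | i , p , q = suc i , p , cong suc q

module Verification (G : Graph) (I : GroupedIncidence G) where
  open Graph G
  open GroupedIncidence I
  open GroupedLabels G I
  open Enumeration G renamingOf
  open NR G renamingOf

  row : Fin m → List ℕ
  row e = toℕ (tail e) ∷ toℕ (head e) ∷ label e ∷ []

  incidence : Fin n → List ℕ
  incidence v = length (edgesAt v) ∷ map toℕ (edgesAt v)

  input output layout : List ℕ
  namesAt graphAt : ℕ
  input = encodeGraph G I
  -- At least the length of the input: the incidence lists have at most 2m
  -- entries in all.
  namesAt = 3 + (m + m + m) + n + m + m
  graphAt = namesAt + m + m + m + m
  output = length vertices ∷ length edges ∷ flatten pairs
  -- The zeros fill the gap that arises because `namesAt` only bounds the length of the input.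
  layout = input ++ replicate (namesAt ∸ length input) 0 ++ concatMap names (allFin m) ++ output

  T M₀ : ℕ → ℕ
  T i = fromMaybe 0 (layout at i)
  M₀ i = fromMaybe 0 (input at i)

  open Machine T
  open Output (2 + graphAt) (2 + graphAt + length (flatten pairs)) (length edges)

  -- A cell that contains `x` and is meant to contain it at the end can be read at any later time.
  -- The whole input is held because `layout` begins with it.
  Held : (ℕ → ℕ) → ℕ → ℕ → Set
  Held M a x = M a ≡ x × T a ≡ x

  held : ∀ {M M′ a x} → M ⊑ M′ → Held M a x → M′ a ≡ x
  held {a = a} g (p , q) = trans (stays g a (trans p (sym q))) q

  record Ready (s : Store) : Set where
    constructor ready
    field
      one≡   : regs s $one ≡ 1
      three≡ : regs s $three ≡ 3
      B≡     : regs s $B ≡ namesAt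
      loaded : M₀ ⊑ cells s
  open Ready

  ready-kept : ∀ {c s t s′} → Exec c s t s′ → cells s ⊑ cells s′ →
               keeps $one c ≡ true → keeps $three c ≡ true → keeps $B c ≡ true → Ready s → Ready s′
  ready-kept x g p q r (ready one≡ three≡ B≡ loaded) =
    ready (trans (kept x _ p) one≡) (trans (kept x _ q) three≡) (trans (kept x _ r) B≡) (⊑-trans loaded g)

  record Named (v : Fin n) (e : Fin m) (M : ℕ → ℕ) : Set where
    constructor named
    a : ℕ
    a = namesAt + toℕ e * 4
    field
      atTail : tail e ≡ v → M a ≡ T a × M (1 + a) ≡ T (1 + a)
      atHead : head e ≡ v → M (2 + a) ≡ T (2 + a) × M (3 + a) ≡ T (3 + a)

  Named-grow : ∀ {v e M M′} → M ⊑ M′ → Named v e M → Named v e M′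
  Named-grow g (named t h) = named
    (λ eq → stays g _ (proj₁ (t eq)) , stays g _ (proj₂ (t eq)))
    (λ eq → stays g _ (proj₁ (h eq)) , stays g _ (proj₂ (h eq)))

  private
    contents : List ℕ → ℕ → ℕ
    contents xs i = fromMaybe 0 (xs at i)

    Stored-contents : ∀ pre xs post {ys} → ys ≡ pre ++ xs ++ post →
                      Stored (λ a x → contents ys a ≡ x) (length pre) xs
    Stored-contents pre xs post refl = Stored-map xs (λ _ _ _ → cong (fromMaybe 0)) (Stored-at pre xs post)

    beyond : List ℕ
    beyond = replicate (namesAt ∸ length input) 0 ++ concatMap names (allFin m) ++ output

    Stored-input : ∀ pre xs post → input ≡ pre ++ xs ++ post → Stored (Held M₀) (length pre) xs
    Stored-input pre xs post eq = Stored-zip xs (Stored-contents pre xs post eq)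
      (Stored-contents pre xs (post ++ beyond)
        (trans (cong (_++ beyond) eq)
          (trans (++-assoc pre (xs ++ post) beyond) (cong (pre ++_) (++-assoc xs post beyond)))))

    header rows incidenceLists : List ℕ
    header = kindCode kind ∷ n ∷ m ∷ []
    rows = concatMap row (allFin m)
    incidenceLists = concatMap incidence (allFin n)

    length-rows : length rows ≡ m * 3
    length-rows = trans (length-blocks {ρ = λ _ _ → ⊤} row (λ _ → refl) (allFin m)) (cong (_* 3) (length-tabulate {n = m} id))

    length-incidenceLists : length incidenceLists ≤ n + (m + m)
    length-incidenceLists = begin
      length incidenceLists                             ≡⟨ length-concatMap incidence (allFin n) ⟩
      total (length ∘ incidence) (allFin n)         ≡⟨ total-cong (λ v → cong suc (length-map toℕ (edgesAt v))) (allFin n) ⟩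
      total (λ v → 1 + degree v) (allFin n)         ≡⟨ total-+ (allFin n) ⟩
      length (allFin n) + total degree (allFin n)   ≤⟨ +-mono-≤ (≤-reflexive (length-tabulate {n = n} id)) total-degree ⟩
      n + 2 * m                                     ≡⟨ cong (λ l → n + (m + l)) (+-identityʳ m) ⟩
      n + (m + m)                                   ∎
      where
      open ≤-Reasoning
      swap : ∀ d l t → d + (l + t) ≡ l + (d + t)
      swap = solve-∀
      total-+ : ∀ vs → total (λ v → 1 + degree v) vs ≡ length vs + total degree vs
      total-+ []       = refl
      total-+ (v ∷ vs) = trans (cong (λ l → suc (degree v + l)) (total-+ vs)) (cong suc (swap (degree v) (length vs) (total degree vs)))

    length-input : length input ≤ namesAt
    length-input = begin
      length input                          ≡⟨ cong (3 +_) (length-++ rows) ⟩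
      3 + (length rows + length incidenceLists) ≤⟨ +-monoʳ-≤ 3 (+-mono-≤ (≤-reflexive length-rows) length-incidenceLists) ⟩
      3 + (m * 3 + (n + (m + m)))           ≡⟨ regroup m n ⟩
      namesAt                               ∎
      where
      open ≤-Reasoning
      regroup : ∀ m n → 3 + (m * 3 + (n + (m + m))) ≡ 3 + (m + m + m) + n + m + m
      regroup = solve-∀

    padded : List ℕ
    padded = input ++ replicate (namesAt ∸ length input) 0

    length-padded : length padded ≡ namesAt
    length-padded = trans (length-++ input)
      (trans (cong (length input +_) (length-replicate _)) (m+[n∸m]≡n length-input))

    allNames : List ℕ
    allNames = concatMap names (allFin m)

  headerStored : Stored (Held M₀) 0 (kindCode kind ∷ n ∷ m ∷ [])
  headerStored = Stored-input [] header (rows ++ incidenceLists) refl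

  rowsStored : ∀ e → Stored (Held M₀) (3 + toℕ e * 3) (row e)
  rowsStored = Stored-blocks⁻ row (λ _ → refl) id (Stored-input header rows incidenceLists refl)

  incidencesStored : Stored (Held M₀) (3 + (m + m + m)) (concatMap incidence (allFin n))
  incidencesStored = subst (λ a → Stored (Held M₀) a incidenceLists) (cong (3 +_) (trans length-rows (triple m)))
    (Stored-input (header ++ rows) incidenceLists [] (cong (header ++_) (cong (rows ++_) (sym (++-identityʳ incidenceLists)))))
    where
    triple : ∀ m → m * 3 ≡ m + m + m
    triple = solve-∀

  allNamesStored : Stored (λ a x → T a ≡ x) namesAt (concatMap names (allFin m))
  allNamesStored = subst (λ a → Stored (λ a x → T a ≡ x) a allNames) length-padded
    (Stored-contents padded allNames output (sym (++-assoc input _ (allNames ++ output))))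

  namesStored : ∀ e → Stored (λ a x → T a ≡ x) (namesAt + toℕ e * 4) (names e)
  namesStored = Stored-blocks⁻ names (λ _ → refl) id allNamesStored

  outputStored : Stored (λ a x → T a ≡ x) graphAt output
  outputStored = subst (λ a → Stored (λ a x → T a ≡ x) a output)
    (trans (length-++ padded) (trans (cong₂ _+_ length-padded
      (trans (length-blocks {ρ = λ _ _ → ⊤} names (λ _ → refl) (allFin m)) (cong (_* 4) (length-tabulate {n = m} id))))
      (quadruple namesAt m)))
    (Stored-contents (padded ++ allNames) output [] (sym (begin
      (padded ++ allNames) ++ output ++ []  ≡⟨ cong ((padded ++ allNames) ++_) (++-identityʳ output) ⟩
      (padded ++ allNames) ++ output        ≡⟨ ++-assoc padded allNames output ⟩
      padded ++ allNames ++ output          ≡⟨ ++-assoc input _ (allNames ++ output) ⟩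
      layout                                ∎)))
    where
    open ≡-Reasoning
    quadruple : ∀ a m → a + m * 4 ≡ a + m + m + m + m
    quadruple = solve-∀

  private
    vnum-plain : ∀ {v w} (x : LabelAt w) i → w ≡ v → lookup (labelsAt v) i ≡ value x →
                 vnum (vertex w x) ≡ base v + toℕ i * 2
    vnum-plain {v} x i refl eq = cong (λ j → base v + toℕ j * 2) (rename-from v x i eq)

    vnum-barred : ∀ {v w} (x : LabelAt w) i → w ≡ v → lookup (labelsAt v) i ≡ value x →
                  vnum (vertex̄ w x) ≡ 1 + (base v + toℕ i * 2)
    vnum-barred {v} x i refl eq = trans (cong (λ j → base v + suc (toℕ j * 2)) (rename-from v x i eq)) (+-suc (base v) _)

  -- The invariant of the scan of v, when the edges es are still to be scanned.
  record Scanning (v : Fin n) (p : ℕ) (es : List (Fin m)) (s : Store) : Set where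
    constructor scanning
    field
      isReady : Ready s
      len≡    : regs s $len ≡ length es
      ptr≡    : regs s $ptr ≡ p
      entries : Stored (Held M₀) p (map toℕ es)
      {done}  : List ℕ
      k≡      : regs s $k ≡ length done
      split   : labelsAt v ≡ done ++ groups (regs s $prev) (map label es)
      -- When a group is in progress, `$plain` still holds the vertex of its label.
      current : ∀ {x} → regs s $prev ≡ suc x →
                ∃ λ i → lookup (labelsAt v) i ≡ x × regs s $plain ≡ base v + toℕ i * 2
      v≡      : regs s $v ≡ toℕ v
      b≡      : regs s $b ≡ base v

  -- What the two branches of the test for a new group have in common; the rest of the step need not
  -- know which one was taken.
  record Located (v : Fin n) (e : Fin m) (es : List (Fin m)) (s : Store) : Set where
    constructor located
    field
      {done} : List ℕ
      k≡     : regs s $k ≡ length done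
      split  : labelsAt v ≡ done ++ groups (suc (label e)) (map label es)
      prev≡  : regs s $prev ≡ suc (label e)
      i      : Fin (length (labelsAt v))
      lookup≡ : lookup (labelsAt v) i ≡ label e
      plain≡ : regs s $plain ≡ base v + toℕ i * 2

  scanStep : ∀ {v p e es s} → Scanning v p (e ∷ es) s →
             Run scanBody s 43 (λ s′ → Scanning v (suc p) es s′ × Named v e (cells s′))
  scanStep {v} {p} {e} {es} {s} (scanning r len≡ ptr≡ (entry , entries) {done} k≡ split current v≡ b≡) =
    assign ⊑-refl (run-⨟ (run-ifz old new) λ {s₂} x₂ g₂ loc →
      let module L = Located loc
          r₂ = ready-kept x₂ g₂ refl refl refl r₁
          e₂ = trans (kept x₂ $e refl) e≡
          v₂ = trans (kept x₂ $v refl) v≡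
          tail₂ = trans (kept x₂ $tail refl) tail≡
          name₀≡ = address r₂ e₂
          name₁≡ = cong₂ _+_ (one≡ r₂) name₀≡
          name₂≡ = cong₂ _+_ (one≡ r₂) name₁≡
          name₃≡ = cong₂ _+_ (one≡ r₂) name₂≡
          barred≡ = cong₂ _+_ (one≡ r₂) L.plain≡
      in assign ⊑-refl (run-⨟
        (run-ifz
          (λ eq → let (w , p , q) = writeTail L.i L.lookup≡ name₀≡ name₁≡ L.plain≡ barred≡
                        (toℕ-injective (trans (sym tail₂) (trans (difference-zero _ _ eq) v₂)))
                  in run-ops {Q = TailNamed} _ w (λ _ → p , q))
          (λ eq → weaken z≤n (run-ops [] ⊑-refl
            (λ t → contradiction (trans tail₂ (trans (cong toℕ t) (sym v₂))) (difference-suc eq)))))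
        λ x₃ g₃ tailNamed →
          let v₃ = trans (kept x₃ $v refl) v₂
              head₃ = trans (kept x₃ $head refl) (trans (kept x₂ $head refl) head≡)
          in assign ⊑-refl (run-⨟
          (run-ifz
            (λ eq → let (w , p , q) = writeHead L.i L.lookup≡
                          (trans (kept x₃ $name₂ refl) name₂≡) (trans (kept x₃ $name₃ refl) name₃≡)
                          (trans (kept x₃ $plain refl) L.plain≡) (trans (kept x₃ $barred refl) barred≡)
                          (toℕ-injective (trans (sym head₃) (trans (difference-zero _ _ eq) v₃)))
                    in run-ops {Q = HeadNamed} _ w (λ _ → p , q))
            (λ eq → weaken z≤n (run-ops [] ⊑-refl
              (λ t → contradiction (trans head₃ (trans (cong toℕ t) (sym v₃))) (difference-suc eq)))))
          λ x₄ g₄ headNamed →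
            let prev₄ = trans (kept x₄ $prev refl) (trans (kept x₃ $prev refl) L.prev≡)
                plain₄ = trans (kept x₄ $plain refl) (trans (kept x₃ $plain refl) L.plain≡)
                r₃ = ready-kept x₃ g₃ refl refl refl (ready (one≡ r₂) (three≡ r₂) (B≡ r₂) (loaded r₂))
                r₄ = ready-kept x₄ g₄ refl refl refl (ready (one≡ r₃) (three≡ r₃) (B≡ r₃) (loaded r₃))
            in run-ops _ ⊑-refl
              (scanning (ready (one≡ r₄) (three≡ r₄) (B≡ r₄) (loaded r₄))
                (trans (cong₂ _∸_ (trans (kept x₄ $len refl) (trans (kept x₃ $len refl) (trans (kept x₂ $len refl) len≡))) (one≡ r₄)) refl)
                (trans (kept x₄ $ptr refl) (trans (kept x₃ $ptr refl) (trans (kept x₂ $ptr refl) ptr₁)))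
                entries
                (trans (kept x₄ $k refl) (trans (kept x₃ $k refl) L.k≡))
                (trans L.split (cong (λ p → L.done ++ groups p (map label es)) (sym prev₄)))
                (λ eq → L.i , trans L.lookup≡ (suc-injective (trans (sym prev₄) eq)) , plain₄)
                (trans (kept x₄ $v refl) v₃)
                (trans (kept x₄ $b refl) (trans (kept x₃ $b refl) (trans (kept x₂ $b refl) b≡))) ,
               named (λ t → stays g₄ _ (proj₁ (tailNamed t)) , stays g₄ _ (proj₂ (tailNamed t))) headNamed))))
    where
    a = namesAt + toℕ e * 4
    TailNamed HeadNamed : Store → Set
    TailNamed s = tail e ≡ v → cells s a ≡ T a × cells s (1 + a) ≡ T (1 + a)
    HeadNamed s = head e ≡ v → cells s (2 + a) ≡ T (2 + a) × cells s (3 + a) ≡ T (3 + a)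

    prefix = load $e $ptr ∷ add $ptr $ptr $one ∷
      add $addr $e $e ∷ add $addr $addr $e ∷ add $addr $three $addr ∷ load $tail $addr ∷
      add $addr $one $addr ∷ load $head $addr ∷ add $addr $one $addr ∷ load $label $addr ∷
      add $label $one $label ∷ difference $label $prev
    s₁ = run prefix s

    r₁ : Ready s₁
    r₁ = ready (one≡ r) (three≡ r) (B≡ r) (loaded r)

    read : ∀ {a b x} → a ≡ b → Held M₀ b x → cells s a ≡ x
    read refl h = held (loaded r) h

    e≡ : regs s₁ $e ≡ toℕ e
    e≡ = read ptr≡ entry
    triple : ∀ e → 3 + (e + e + e) ≡ 3 + e * 3
    triple = solve-∀
    addr≡ : regs s $three + (regs s₁ $e + regs s₁ $e + regs s₁ $e) ≡ 3 + toℕ e * 3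
    addr≡ = trans (cong₂ (λ t e → t + (e + e + e)) (three≡ r) e≡) (triple (toℕ e))
    addr₁≡ = cong₂ _+_ (one≡ r) addr≡
    addr₂≡ = cong₂ _+_ (one≡ r) addr₁≡
    tail≡ : regs s₁ $tail ≡ toℕ (tail e)
    tail≡ = read addr≡ (proj₁ (rowsStored e))
    head≡ : regs s₁ $head ≡ toℕ (head e)
    head≡ = read addr₁≡ (proj₁ (proj₂ (rowsStored e)))
    label≡ : regs s₁ $label ≡ suc (label e)
    label≡ = cong₂ _+_ (one≡ r) (read addr₂≡ (proj₁ (proj₂ (proj₂ (rowsStored e)))))
    ptr₁ : regs s₁ $ptr ≡ suc p
    ptr₁ = trans (cong₂ _+_ ptr≡ (one≡ r)) (+-comm p 1)

    old : regs s₁ $diff ≡ 0 → Run (ops []) s₁ 5 (Located v e es)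
    -- Equality with `$prev` means that the group of the preceding edge continues, so `current`
    -- supplies position and vertex.
    old eq with prev≡ ← trans (sym (difference-zero _ _ eq)) label≡
           with i , lookup≡ , plain≡ ← current prev≡ =
      weaken z≤n (run-ops [] ⊑-refl (located k≡
        (trans split (cong (done ++_) (trans (cong (λ p → groups p (label e ∷ map label es)) prev≡) (groups-old (map label es) refl))))
        prev≡ i lookup≡ plain≡))

    new : ∀ {j} → regs s₁ $diff ≡ suc j → Run (ops _) s₁ 5 (Located v e es)
    -- The new label stands right behind `done` in `labelsAt v`, so its position is the number of
    -- groups met so far, which is `$k`.
    new eq with split′ ← trans split (cong (done ++_) (groups-new (map label es)
                  (λ eq′ → difference-suc eq (trans label≡ eq′))))
           with i , lookup≡ , i≡ ← lookup-middle done (label e) _ split′ =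
      run-ops _ ⊑-refl (located
        (trans (cong₂ _+_ k≡ (one≡ r)) (sym (length-++ done)))
        (trans split′ (sym (++-assoc done (label e ∷ []) _)))
        (trans (+-identityʳ _) label≡) i lookup≡
        (trans (cong₂ (λ b k → b + k + k) b≡ (trans k≡ (sym i≡))) (+-double (base v) (toℕ i))))

    address : ∀ {s} → Ready s → regs s $e ≡ toℕ e →
              regs s $B + ((regs s $e + regs s $e) + (regs s $e + regs s $e)) ≡ a
    address r e≡ = trans (cong₂ (λ b e → b + ((e + e) + (e + e))) (B≡ r) e≡) (cong (namesAt +_) (four (toℕ e)))
      where
      four : ∀ e → (e + e) + (e + e) ≡ e * 4
      four = solve-∀

    writeAt : ∀ {M c b x y} a → c ≡ a → b ≡ 1 + a → T a ≡ x → T (1 + a) ≡ y → let M′ = (M [ c ≔ x ]) [ b ≔ y ] in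
              M ⊑ M′ × M′ a ≡ T a × M′ (1 + a) ≡ T (1 + a)
    writeAt a refl refl p q = writes p q

    writeTail : ∀ {M c b x y} i → lookup (labelsAt v) i ≡ label e →
                c ≡ a → b ≡ 1 + a → x ≡ base v + toℕ i * 2 → y ≡ 1 + (base v + toℕ i * 2) → tail e ≡ v →
                let M′ = (M [ c ≔ x ]) [ b ≔ y ] in
                M ⊑ M′ × M′ a ≡ T a × M′ (1 + a) ≡ T (1 + a)
    writeTail i lookup≡ c≡ b≡ x≡ y≡ t with p , q , _ ← namesStored e = writeAt a c≡ b≡
      (trans p (trans (vnum-plain (labelAtTail e) i t lookup≡) (sym x≡)))
      (trans q (trans (vnum-barred (labelAtTail e) i t lookup≡) (sym y≡)))

    writeHead : ∀ {M c b x y} i → lookup (labelsAt v) i ≡ label e →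
                c ≡ 2 + a → b ≡ 3 + a → x ≡ base v + toℕ i * 2 → y ≡ 1 + (base v + toℕ i * 2) → head e ≡ v →
                let M′ = (M [ c ≔ x ]) [ b ≔ y ] in
                M ⊑ M′ × M′ (2 + a) ≡ T (2 + a) × M′ (3 + a) ≡ T (3 + a)
    writeHead i lookup≡ c≡ b≡ x≡ y≡ h with _ , _ , p , q , _ ← namesStored e = writeAt (2 + a) c≡ b≡
      (trans p (trans (vnum-plain (labelAtHead e) i h lookup≡) (sym x≡)))
      (trans q (trans (vnum-barred (labelAtHead e) i h lookup≡) (sym y≡)))

  scanLoop : ∀ {v} es {p s} → Scanning v p es s →
             Run (while $len scanBody) s (1 + length es * 45)
               (λ s′ → Scanning v (p + length es) [] s′ × (∀ e → e ∈ es → Named v e (cells s′)))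
  scanLoop {v} [] {p} {s} sc = run-stop (Scanning.len≡ sc)
    (subst (λ p → Scanning v p [] s) (sym (+-identityʳ p)) sc , λ _ ())
  scanLoop {v} (e ∷ es) {p} sc = run-loop (Scanning.len≡ sc) (scanStep sc) λ { _ _ (sc′ , named-e) →
    let mkRun {fin} x f g (sc″ , named-es) = scanLoop es sc′
    in mkRun x f g
      (subst (λ p → Scanning v p [] fin) (sym (+-suc p (length es))) sc″ ,
       λ { e′ (here refl) → Named-grow g named-e ; e′ (there e∈) → named-es e′ e∈ }) }

  -- The invariant of the main loop, when the gadgets of vs are still to be built.
  record Visiting (vs : List (Fin n)) (s : Store) : Set where
    constructor visiting
    field
      isReady : Ready s
      n≡      : regs s $n ≡ length vs
      indices : Consecutive toℕ (regs s $v) vs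
      isLaid  : Laid (regs s $b) vs
      entries : Stored (Held M₀) (regs s $ptr) (concatMap incidence vs)
      reached : regs s $b + total gadgetSize vs ≡ length vertices
      unbuilt : Out s (concatMap gadgetPairsAt vs ++ concatMap arcPairs (allFin m))

  private
    -- 30 steps are charged to one incident edge, 45 to each entry of the list, and 60 to each label
    -- over all levels, of which there are at most three per incident edge: 30 + 45 + 180 = 255.
    vertex-cost : ∀ v → 2 + (4 + ((1 + degree v * 45) + ((21 + labels (halvingAt v) * 60) + 2))) ≤ 255 * degree v
    vertex-cost v = begin
      2 + (4 + ((1 + d * 45) + ((21 + labels (halvingAt v) * 60) + 2)))
        ≡⟨ regroup d (labels (halvingAt v)) ⟩
      30 * 1 + (d * 45 + labels (halvingAt v) * 60)
        ≤⟨ +-mono-≤ (*-monoʳ-≤ 30 (degree≥1 v)) (+-monoʳ-≤ (d * 45) (*-monoˡ-≤ 60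
             (≤-trans (labels≤ (halvingAt v)) (*-monoʳ-≤ 3 (labelsAt≤degree v))))) ⟩
      30 * d + (d * 45 + 3 * d * 60)
        ≡⟨ regroup′ d ⟩
      255 * d ∎
      where
      open ≤-Reasoning
      d = degree v
      regroup : ∀ d l → 2 + (4 + ((1 + d * 45) + ((21 + l * 60) + 2))) ≡ 30 * 1 + (d * 45 + l * 60)
      regroup = solve-∀
      regroup′ : ∀ d → 30 * d + (d * 45 + 3 * d * 60) ≡ 255 * d
      regroup′ = solve-∀

  vertexStep : ∀ {v vs s} → Visiting (v ∷ vs) s →
               Run vertexBody s (4 + ((1 + degree v * 45) + ((21 + labels (halvingAt v) * 60) + 2)))
                 (λ s′ → Visiting vs s′ × (∀ e → e ∈ edgesAt v → Named v e (cells s′)))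
  vertexStep {v} {vs} {s} (visiting r n≡ (v≡ , indices) (b≡ , isLaid) (len-held , entries) reached unbuilt) =
    assign ⊑-refl (run-⨟ (scanLoop (edgesAt v) start) λ { {s₂} x₂ g₂ (sc , named₂) →
      let module S = Scanning sc
          r₂ = S.isReady
          out₂ = Out-grow {s = s} {s′ = s₂} (kept x₂ $q refl) (kept x₂ $count refl) g₂ unbuilt
          -- No entries are left, so `done` is all of `labelsAt v` and `$k` is the size parameter of
          -- the gadget.
          k≡ = trans S.k≡ (cong length (trans (sym (++-identityʳ S.done)) (sym S.split)))
      in run-⨟ (gadgetRun (halvingAt v) s₂ (one≡ r₂) k≡ S.b≡
                 (subst (Out s₂) (++-assoc (gadgetPairsAt v) _ _) out₂))
      λ { {s₃} x₃ g₃ (out₃ , b₃) →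
        let r₃ = ready-kept x₃ g₃ refl refl refl r₂
            b₃′ = trans b₃ (cong (_+ gadgetSize v) b≡)
        in run-ops _ ⊑-refl
          (visiting (ready (one≡ r₃) (three≡ r₃) (B≡ r₃) (loaded r₃))
            (cong₂ _∸_ (trans (kept x₃ $n refl) (trans (kept x₂ $n refl) n≡)) (one≡ r₃))
            (subst (λ i → Consecutive toℕ i vs)
              (sym (trans (cong₂ _+_ (trans (kept x₃ $v refl) (trans S.v≡ v≡)) (one≡ r₃)) (+-comm (regs s $v) 1)))
              indices)
            (subst (λ b → Laid b vs) (sym b₃′) isLaid)
            (subst (λ a → Stored (Held M₀) a (concatMap incidence vs))
              (sym (trans (kept x₃ $ptr refl) S.ptr≡))
              (proj₂ edgeEntries))
            (trans (cong (_+ total gadgetSize vs) b₃′) (trans (+-assoc (regs s $b) _ _) reached))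
            out₃ ,
           λ e e∈ → Named-grow g₃ (named₂ e e∈)) } })
    where
    p = suc (regs s $ptr)
    edgeEntries : Stored (Held M₀) p (map toℕ (edgesAt v)) ×
                  Stored (Held M₀) (p + length (edgesAt v)) (concatMap incidence vs)
    edgeEntries with q , q′ ← Stored-++ (map toℕ (edgesAt v)) entries =
      q , subst (λ l → Stored (Held M₀) (p + l) (concatMap incidence vs)) (length-map toℕ (edgesAt v)) q′
    start : Scanning v p (edgesAt v)
              (run (load $len $ptr ∷ add $ptr $ptr $one ∷ const $k 0 ∷ const $prev 0 ∷ []) s)
    start = scanning (ready (one≡ r) (three≡ r) (B≡ r) (loaded r))
      (held (loaded r) len-held) (trans (cong (regs s $ptr +_) (one≡ r)) (+-comm (regs s $ptr) 1))
      (proj₁ edgeEntries) {[]} refl refl (λ ()) (sym v≡) (sym b≡)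

  vertexLoop : ∀ vs {s} → Visiting vs s →
               Run (while $n vertexBody) s (1 + total (λ v → 255 * degree v) vs)
                 (λ s′ → Visiting [] s′ × (∀ v → v ∈ vs → ∀ e → e ∈ edgesAt v → Named v e (cells s′)))
  vertexLoop []       vis = run-stop (Visiting.n≡ vis) (vis , λ _ ())
  vertexLoop (v ∷ vs) vis = weaken (cost v)
    (run-loop (Visiting.n≡ vis) (vertexStep vis) λ { _ _ (vis′ , named-v) →
      let mkRun x f g (vis″ , named-vs) = vertexLoop vs vis′
      in mkRun x f g (vis″ , λ { v (here refl) e e∈ → Named-grow g (named-v e e∈)
                               ; v (there v∈) → named-vs v v∈ }) })
    where
    l = total (λ v → 255 * degree v) vs
    cost : ∀ v → let c = 4 + ((1 + degree v * 45) + ((21 + labels (halvingAt v) * 60) + 2)) in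
           2 + (c + (1 + l)) ≤ 1 + (255 * degree v + l)
    cost v = ≤-trans (≤-reflexive (shift (4 + ((1 + degree v * 45) + ((21 + labels (halvingAt v) * 60) + 2))) l)) (s≤s (+-monoˡ-≤ l (vertex-cost v)))
      where
      shift : ∀ c l → 2 + (c + (1 + l)) ≡ 1 + (2 + c + l)
      shift = solve-∀

  -- M is the memory at the time when the table of names was completed.
  record Linking (κ : Kind) (M : ℕ → ℕ) (es : List (Fin m)) (s : Store) : Set where
    constructor linking
    field
      one≡    : regs s $one ≡ 1
      kind≡   : regs s $kind ≡ kindCode κ
      m≡      : regs s $m ≡ length es
      entries : Stored (Held M) (regs s $name₀) (concatMap names es)
      since   : M ⊑ cells s
      unbuilt : Out s (concatMap (λ e → map (arcPair e) (directions κ)) es)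

  arcStep : ∀ {κ M e es s} → Linking κ M (e ∷ es) s → Run arcBody s 21 (Linking κ M es)
  arcStep {κ} {M} {e} {es} {s} (linking one≡ kind≡ m≡ (x , x₁ , x₂ , x₃ , entries) since unbuilt) =
    assign ⊑-refl (run-⨟
      (run-emits {ps = back κ ++ rest} ((refl , refl) ∷ []) one≡
        (cong₂ (λ p q → (p , q) ∷ []) (read a₁ x₁) (read a₂ x₂))
        (subst (Out s) (split κ) unbuilt))
      λ {s₂} y₂ g₂ out₂ → run-⨟ {Q = λ s → Out s rest} (run-ifz
        (λ eq → weaken z≤n (run-ops [] ⊑-refl (noBack {s = s₂} κ (trans (sym eq) (trans (kept y₂ $kind refl) kind≡)) out₂)))
        (λ eq → run-emits ((refl , refl) ∷ []) (trans (kept y₂ $one refl) one≡)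
          (cong₂ (λ p q → (p , q) ∷ [])
            (trans (kept y₂ $x₃ refl) (read a₃ x₃))
            (trans (kept y₂ $x refl) (held since x)))
          (isBack {s = s₂} κ (trans (sym eq) (trans (kept y₂ $kind refl) kind≡)) out₂)))
      λ y₃ g₃ out₃ → run-ops _ ⊑-refl (linking
        (trans (kept y₃ $one refl) (trans (kept y₂ $one refl) one≡))
        (trans (kept y₃ $kind refl) (trans (kept y₂ $kind refl) kind≡))
        (cong₂ _∸_ (trans (kept y₃ $m refl) (trans (kept y₂ $m refl) m≡)) (trans (kept y₃ $one refl) (trans (kept y₂ $one refl) one≡)))
        (subst (λ a → Stored (Held M) a (concatMap names es))
          (sym (trans (kept y₃ $name₀ refl) (trans (kept y₂ $name₀ refl) a₄))) entries)
        (⊑-trans since (⊑-trans g₂ g₃)) out₃))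
    where
    a = regs s $name₀
    o = regs s $one
    a₁ : o + a ≡ 1 + a
    a₁ = cong (_+ a) one≡
    a₂ : o + (o + a) ≡ 2 + a
    a₂ = cong₂ _+_ one≡ a₁
    a₃ : o + (o + (o + a)) ≡ 3 + a
    a₃ = cong₂ _+_ one≡ a₂
    a₄ : o + (o + (o + (o + a))) ≡ 4 + a
    a₄ = cong₂ _+_ one≡ a₃
    read : ∀ {b c x} → b ≡ c → Held M c x → cells s b ≡ x
    read refl = held since
    rest = concatMap (λ e → map (arcPair e) (directions κ)) es
    back : Kind → List (ℕ × ℕ)
    back directed   = []
    back undirected = arcPair e backward ∷ []
    split : ∀ κ → map (arcPair e) (directions κ) ++ rest ≡ arcPair e {κ} forward ∷ back κ ++ rest
    split directed   = refl
    split undirected = refl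
    noBack : ∀ {s} κ → 0 ≡ kindCode κ → Out s (back κ ++ rest) → Out s rest
    noBack directed _ out = out
    isBack : ∀ {s j} κ → suc j ≡ kindCode κ → Out s (back κ ++ rest) → Out s (arcPair e backward ∷ rest)
    isBack undirected _ out = out

  arcLoop : ∀ {κ M} es {s} → Linking κ M es s →
            Run (while $m arcBody) s (1 + length es * 23) (λ s′ → Out s′ [])
  arcLoop []       link = run-stop (Linking.m≡ link) (Linking.unbuilt link)
  arcLoop (e ∷ es) link = run-loop (Linking.m≡ link) (arcStep link) λ _ _ link′ → arcLoop es link′

  record Final (s : Store) : Set where
    field
      A≡    : regs s $A ≡ graphAt
      B≡    : regs s $B ≡ namesAt
      graphStored : Stored (λ a x → cells s a ≡ x) graphAt output
      namesTable  : Stored (λ a x → cells s a ≡ x) namesAt (concatMap names (allFin m))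

  private
    record Loaded (s : Store) : Set where
      constructor loadedBy
      field
        one≡   : regs s $one ≡ 1
        three≡ : regs s $three ≡ 3
        kind≡  : regs s $kind ≡ kindCode kind
        n≡     : regs s $n ≡ n
        m≡     : regs s $m ≡ m
        v≡     : regs s $v ≡ 0
        b≡     : regs s $b ≡ 0
        count≡ : regs s $count ≡ 0
        since  : M₀ ⊑ cells s

    load₁ : Run (ops _) ((λ _ → 0) , M₀) 7 Loaded
    load₁ with (kind≡ , _) , (n≡ , _) , (m≡ , _) , _ ← headerStored =
      run-ops (const $one 1 ∷ const $three 3 ∷ const $tmp 0 ∷ load $kind $tmp ∷ load $n $one ∷
               add $tmp $one $one ∷ load $m $tmp ∷ [])
        -- `$v`, `$b` and `$count` are 0 because all registers are at the start.
        ⊑-refl (loadedBy refl refl kind≡ n≡ m≡ refl refl refl ⊑-refl)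

    load₂ : ∀ {s} → Loaded s → Run (ops _) s 6 (λ s′ → Loaded s′ × regs s′ $ptr ≡ 3 + (m + m + m) × regs s′ $B ≡ namesAt)
    load₂ {s} (loadedBy one≡ three≡ kind≡ n≡ m≡ v≡ b≡ count≡ since) =
      run-ops (add $ptr $m $m ∷ add $ptr $ptr $m ∷ add $ptr $three $ptr ∷ add $B $ptr $n ∷ add $B $B $m ∷ add $B $B $m ∷ [])
        ⊑-refl (loadedBy one≡ three≡ kind≡ n≡ m≡ v≡ b≡ count≡ since , ptr≡ ,
                cong₂ _+_ (cong₂ _+_ (cong₂ _+_ ptr≡ n≡) m≡) m≡)
      where
      ptr≡ = cong₂ _+_ three≡ (cong₂ _+_ (cong₂ _+_ m≡ m≡) m≡)

    load₃ : ∀ {s} → Loaded s × regs s $ptr ≡ 3 + (m + m + m) × regs s $B ≡ namesAt →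
            Run (ops _) s 6 (λ s′ → Visiting (allFin n) s′ × Loaded s′ × regs s′ $A ≡ graphAt)
    load₃ {s} (loadedBy one≡ three≡ kind≡ n≡ m≡ v≡ b≡ count≡ since , ptr≡ , B≡) =
      run-ops (add $A $B $m ∷ add $A $A $m ∷ add $A $A $m ∷ add $A $A $m ∷ add $q $one $A ∷ add $q $one $q ∷ [])
        ⊑-refl (visiting (ready one≡ three≡ B≡ since)
          (trans n≡ (sym (length-tabulate {n = n} id)))
          (subst (λ i → Consecutive toℕ i (allFin n)) (sym v≡) (indices n))
          (subst (λ b → Laid b (allFin n)) (sym b≡) laid)
          (subst (λ a → Stored (Held M₀) a (concatMap incidence (allFin n))) (sym ptr≡) incidencesStored)
          (trans (cong (_+ total gadgetSize (allFin n)) b≡) (sym length-vertices))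
          (pending (subst (λ a → Stored (λ a x → T a ≡ x) a (flatten pairs)) (sym q≡) (proj₂ (proj₂ outputStored)))
            (cong (_+ length (flatten pairs)) q≡) (trans (cong (_+ length pairs) count≡) length-pairs)
            -- `$q` is still at the start of the area for the pairs, so there is no cell to check.
            (λ a l u → contradiction (≤-trans u (≤-reflexive q≡)) (≤⇒≯ l))) ,
          loadedBy one≡ three≡ kind≡ n≡ m≡ v≡ b≡ count≡ since , A≡)
      where
      A≡ = cong₂ _+_ (cong₂ _+_ (cong₂ _+_ (cong₂ _+_ B≡ m≡) m≡) m≡) m≡
      q≡ = cong₂ _+_ one≡ (cong₂ _+_ one≡ A≡)
      indices : ∀ n → Consecutive toℕ 0 (allFin n)
      indices n = go 0 id (λ _ → refl)
        where
        go : ∀ {l} i (g : Fin l → Fin n) → (∀ j → toℕ (g j) ≡ i + toℕ j) → Consecutive toℕ i (tabulate g)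
        go {zero}  i g eq = _
        go {suc l} i g eq = trans (eq zero) (+-identityʳ i) , go (suc i) (g ∘ suc) (λ j → trans (eq (suc j)) (+-suc i (toℕ j)))

    -- Each edge is in the incidence lists of both of its ends, so after all visits both halves of
    -- its entry have been filled in.
    Named-all : ∀ {M} → (∀ v → v ∈ allFin n → ∀ e → e ∈ edgesAt v → Named v e M) →
                Stored (Held M) namesAt (concatMap names (allFin m))
    Named-all {M} allNamed = Stored-blocks⁺ names (λ _ → refl) id λ e →
      let t = Named.atTail (allNamed (tail e) (∈-allFin _) e (Equivalence.from (complete _ e) (inj₁ refl))) refl
          h = Named.atHead (allNamed (head e) (∈-allFin _) e (Equivalence.from (complete _ e) (inj₂ refl))) refl
          (p , q , p′ , q′ , _) = namesStored e
      in (trans (proj₁ t) p , p) , (trans (proj₂ t) q , q) , (trans (proj₁ h) p′ , p′) , (trans (proj₂ h) q′ , q′) , _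

  mainRun : Run main ((λ _ → 0) , M₀) (26 + (total (λ v → 255 * degree v) (allFin n) + length (allFin m) * 23)) Final
  mainRun = weaken (≤-reflexive (cost (total (λ v → 255 * degree v) (allFin n)) (length (allFin m) * 23)))
    (run-⨟ load₁ λ _ _ l₁ → run-⨟ (load₂ l₁) λ _ _ l₂ → run-⨟ (load₃ l₂) λ { _ _ (start , l₃ , A₁) →
     run-⨟ (vertexLoop (allFin n) start) λ { {s₂} x₂ g₂ (vis , allNamed) →
      let module V = Visiting vis
          held₂ = Named-all allNamed
          B₂ = Ready.B≡ V.isReady
      in assign ⊑-refl (run-⨟
        (arcLoop {kind} {cells s₂} (allFin m) (linking (Ready.one≡ V.isReady)
          (trans (kept x₂ $kind refl) (Loaded.kind≡ l₃))
          (trans (kept x₂ $m refl) (trans (Loaded.m≡ l₃) (sym (length-tabulate {n = m} id))))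
          (subst (λ a → Stored (Held (cells s₂)) a (concatMap names (allFin m))) (sym (trans (+-identityʳ _) B₂)) held₂)
          ⊑-refl V.unbuilt))
        λ {s₃} x₃ g₃ out₃ →
          let A₃ = trans (kept x₃ $A refl) (trans (kept x₂ $A refl) A₁)
              B₃ = trans (kept x₃ $B refl) B₂
              b₃ = trans (kept x₃ $b refl) (trans (sym (+-identityʳ _)) V.reached)
              c₃ = trans (sym (+-identityʳ _)) (counted out₃)
              one₃ = trans (kept x₃ $one refl) (Ready.one≡ V.isReady)
          in finish s₃ A₃ B₃ b₃ c₃ one₃ out₃ (Stored-map _ (λ _ _ _ (p , q) → held g₃ (p , q) , q) held₂)) } })
    where
    cost : ∀ a b → 7 + (6 + (6 + ((1 + a) + (2 + ((1 + b) + 3))))) ≡ 26 + (a + b)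
    cost = solve-∀
    finish : ∀ s → regs s $A ≡ graphAt → regs s $B ≡ namesAt → regs s $b ≡ length vertices →
             regs s $count ≡ length edges → regs s $one ≡ 1 → Out s [] →
             Stored (Held (cells s)) namesAt (concatMap names (allFin m)) →
             Run (ops (add $tmp $one $A ∷ store $A $b ∷ store $tmp $count ∷ [])) s 3 Final
    finish s A≡ B≡ b≡ c≡ one≡ out tbl = run-ops _ (proj₁ w) (record
      { A≡ = A≡ ; B≡ = B≡
      ; graphStored = trans (proj₁ (proj₂ w′)) (proj₁ outputStored) ,
                      trans (proj₂ (proj₂ w′)) (proj₁ (proj₂ outputStored)) ,
                      -- No pairs are left, so by `reaches` the write pointer is at the end of the
                      -- area and `written` covers all of it.
                      Stored-map (flatten pairs)
                        (λ a l u t≡ → trans (stays (proj₁ w) a (written out a l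
                          (≤-trans u (≤-reflexive (trans (sym (reaches out)) (+-identityʳ _)))))) t≡)
                        (proj₂ (proj₂ outputStored))
      ; namesTable = Stored-map (concatMap names (allFin m)) (λ _ _ _ → held (proj₁ w)) tbl
      })
      where
      tmp≡ : regs s $one + regs s $A ≡ 1 + graphAt
      tmp≡ = cong₂ _+_ one≡ A≡
      M′ = cells (run (add $tmp $one $A ∷ store $A $b ∷ store $tmp $count ∷ []) s)
      w : cells s ⊑ M′ × M′ (regs s $A) ≡ T (regs s $A) × M′ (regs s $one + regs s $A) ≡ T (regs s $one + regs s $A)
      w = writes (trans (cong T A≡) (trans (proj₁ outputStored) (sym b≡)))
                 (trans (cong T tmp≡) (trans (proj₁ (proj₂ outputStored)) (sym c≡)))
      w′ : cells s ⊑ M′ × M′ graphAt ≡ T graphAt × M′ (1 + graphAt) ≡ T (1 + graphAt)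
      w′ = proj₁ w , subst (λ a → M′ a ≡ T a) A≡ (proj₁ (proj₂ w)) , subst (λ a → M′ a ≡ T a) tmp≡ (proj₂ (proj₂ w))

  constructs : ∃₂ λ (t : ℕ) (s : State) → compile 0 main ⊢ initial (encodeGraph G I) ⇓[ t ] s ×
               t ≤ 533 * suc m × Represents-nr G s
  constructs =
    let open Run mainRun
        p , halts = compile-correct main steps
        s = state p (regs final) (cells final)
    in time , s , halts , ≤-trans fast linear , record
      { ρ = renamingOf
      ; ν = ν
      ; ε = ε
      ; storedGraph = subst₂ (StoredAt s)
          (sym (Final.A≡ post)) (sym encodeDigraph-≡) (Stored-lookup output (Final.graphStored post))
      ; storedNames = subst₂ (StoredAt s)
          (sym (Final.B≡ post)) (sym encodeNames-≡) (Stored-lookup (concatMap names (allFin m)) (Final.namesTable post))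
      }
    where
    -- Two ends at 255 steps and the arcs at 23 steps per edge: 2 · 255 + 23 = 533. The 1 in `suc m`
    -- pays for the remaining 26 steps.
    linear : 26 + (total (λ v → 255 * degree v) (allFin n) + length (allFin m) * 23) ≤ 533 * suc m
    linear = begin
      26 + (total (λ v → 255 * degree v) (allFin n) + length (allFin m) * 23)
        ≡⟨ cong₂ (λ a b → 26 + (a + b * 23)) (total-* 255 degree (allFin n)) (length-tabulate {n = m} id) ⟩
      26 + (255 * total degree (allFin n) + m * 23)
        ≤⟨ +-mono-≤ (m≤m+n 26 507) (+-monoˡ-≤ (m * 23) (*-monoʳ-≤ 255 total-degree)) ⟩
      533 + (255 * (2 * m) + m * 23)
        ≡⟨ regroup m ⟩
      533 * (1 + m) ∎
      where
      open ≤-Reasoning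
      regroup : ∀ m → 533 + (255 * (2 * m) + m * 23) ≡ 533 * (1 + m)
      regroup = solve-∀

mainTheorem1 : (∃ λ (C : ℕ) → (G : Graph) (ρ : Renaming G) →
    ∃₂ λ (N M : ℕ) →
    (Digraph.Vertex (nr G ρ) ↔ Fin N) ×
    (Digraph.Edge (nr G ρ) ↔ Fin M) ×
    N ≤ C * Graph.m G ×
    M ≤ C * Graph.m G)
    ×
    (∃₂ λ (P : Program) (C : ℕ) → (G : Graph) (I : GroupedIncidence G) →
    ∃₂ λ (t : ℕ) (s : State) →
    P ⊢ initial (encodeGraph G I) ⇓[ t ] s ×
    t ≤ C * suc (Graph.m G) ×
    Represents-nr G s)
mainTheorem1 =
  (20 , λ G ρ → let open Enumeration G ρ in _ , _ , ν , ε , vertices≤ , edges≤) ,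
  (compile 0 main , 533 , Verification.constructs)
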